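{- Let $G$ be a $2$-connected multigraph. Then the following are equivalent: (1) $G$ satisfies $(\spadesuit)_2$; (2) either $G$ is the $2$-cycle $C_2$, or $G$ can be obtained from cliques $K_4$ by repeated applications of Construction A with $\delta=2$ (i.e. $G$ belongs to the smallest class of multigraphs containing $K_4$ and closed under Construction A with $\delta=2$).
   Context: Multigraphs are finite, undirected, loop-free, and may have parallel edges. $C_2$ is the multigraph with two vertices and two parallel edges between them; $K_4$ is the complete simple graph on four vertices. For a multigraph $G=(V,E)$ and $S\subseteq V$, $E(S)$ denotes the set of edges with both endpoints in $S$, $G|_S$ the induced sub-multigraph on $S$, and $G/E(S)$ the result of contracting $E(S)$. A good flat of a $2$-connected multigraph $G=(V,E)$ is a subset $S\subsetneq V$ such that both $G|_S$ and $G/E(S)$ are $2$-connected. For an integer $\delta\ge 2$ and a $2$-connected multigraph $G=(V,E)$, the weight function $w\colon E\to\{1,\delta-1\}$ is given by $w(e)=1$ if $G\setminus e$ is $2$-connected and $w(e)=\delta-1$ if $G/e$ is $2$-connected; $w(F)=\sum_{e\in F}w(e)$. $G$ satisfies $(\spadesuit)_\delta$ if it possesses such a weight function and (1) $w(E)=\delta(|V|-1)$ and (2) $w(E(S))+1=\delta(|S|-1)$ for every good flat $S$. (For $\delta=2$ all weights equal $1$.) Construction A (parameter $\delta$): given $2$-connected multigraphs $G_1,G_2$ and edges $e_1$ of $G_1$ with $w(e_1)=1$ and $e_2$ of $G_2$ with $w(e_2)=\delta-1$, take the disjoint union, identify the endpoints of $e_1$ with those of $e_2$ (so that $e_1,e_2$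 become one glued edge), and delete the glued edge. -}

module Defs where

open import Data.Nat using (ℕ; zero; suc; _+_; _*_; _∸_; _≤_)
open import Data.Fin using (Fin; zero; suc; _≟_)
open import Data.Bool using (Bool; true; false; not; _∧_; T; if_then_else_)
open import Data.Unit using (⊤; tt)
open import Data.Product using (Σ; Σ-syntax; ∃; ∃-syntax; _×_; _,_; proj₁; proj₂)
open import Data.Sum using (_⊎_; inj₁; inj₂)
open import Function using (_∘_)
open import Function.Bundles using (_↔_; Inverse)
open import Relation.Nullary using (¬_; does)
open import Relation.Binary.PropositionalEquality using (_≡_; _≢_)
open import Relation.Binary.Construct.Closure.ReflexiveTransitive using (Star)

-- Unordered equality of endpoint pairs (edges are undirected)

UEq : {A : Set} → A × A → A × A → Set
UEq (a , b) (c , d) = ((a ≡ c) × (b ≡ d)) ⊎ ((a ≡ d) × (b ≡ c))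

mapPair : {A B : Set} → (A → B) → A × A → B × B
mapPair f (a , b) = f a , f b

record Gr : Set₁ where
  field
    V    : Set
    E    : Set
    ends : E → V × V

open Gr public

Adj : (H : Gr) → (V H → Set) → V H → V H → Set
Adj H P x y = P x × P y × Σ[ e ∈ E H ] UEq (ends H e) (x , y)

ConnectedOn : (H : Gr) → (V H → Set) → Set
ConnectedOn H P = ∀ x y → P x → P y → Star (Adj H P) x y

TwoConn : Gr → Set
TwoConn H =
  (∀ e → proj₁ (ends H e) ≢ proj₂ (ends H e)) ×
  (Σ[ x ∈ V H ] Σ[ y ∈ V H ] x ≢ y) ×
  ConnectedOn H (λ _ → ⊤) ×
  (∀ v → ConnectedOn H (λ x → x ≢ v))

record MGraph : Set where
  field
    n    : ℕ
    m    : ℕ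
    ends : Fin m → Fin n × Fin n

open MGraph public renaming (ends to endsG)

toGr : MGraph → Gr
toGr G = record { V = Fin (n G) ; E = Fin (m G) ; ends = endsG G }

LoopFree : MGraph → Set
LoopFree G = ∀ e → proj₁ (endsG G e) ≢ proj₂ (endsG G e)

Subset : ℕ → Set
Subset k = Fin k → Bool

sumF : ∀ {k} → (Fin k → ℕ) → ℕ
sumF {zero}  f = 0
sumF {suc k} f = f zero + sumF (f ∘ suc)

size : ∀ {k} → Subset k → ℕ
size S = sumF (λ x → if S x then 1 else 0)

inE : (G : MGraph) → Subset (n G) → Fin (m G) → Bool
inE G S e = S (proj₁ (endsG G e)) ∧ S (proj₂ (endsG G e))

induced : (G : MGraph) → Subset (n G) → Gr
induced G S = record
  { V = Σ[ x ∈ Fin (n G) ] T (S x)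
  ; E = Σ[ e ∈ Fin (m G) ] (T (S (proj₁ (endsG G e))) × T (S (proj₂ (endsG G e))))
  ; ends = λ { (e , p , q) → (proj₁ (endsG G e) , p) , (proj₂ (endsG G e) , q) }
  }

-- quotient: identify all vertices of S into one new vertex (tt),
-- keeping exactly the edges selected by `keep` (endpoints mapped)
QV : (G : MGraph) → Subset (n G) → Set
QV G S = (Σ[ x ∈ Fin (n G) ] T (not (S x))) ⊎ ⊤

private
  go : {X : Set} (b : Bool) → (T (not b) → X) → X ⊎ ⊤
  go true  k = inj₂ tt
  go false k = inj₁ (k tt)

qmap : (G : MGraph) (S : Subset (n G)) → Fin (n G) → QV G S
qmap G S x = go (S x) (λ p → x , p)

quot : (G : MGraph) → Subset (n G) → (Fin (m G) → Bool) → Gr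
quot G S keep = record
  { V = QV G S
  ; E = Σ[ e ∈ Fin (m G) ] T (keep e)
  ; ends = λ { (e , _) → mapPair (qmap G S) (endsG G e) }
  }

contractSet : (G : MGraph) → Subset (n G) → Gr
contractSet G S = quot G S (λ e → not (inE G S e))

delete : (G : MGraph) → Fin (m G) → Gr
delete G e = record
  { V = Fin (n G)
  ; E = Σ[ f ∈ Fin (m G) ] T (not (does (f ≟ e)))
  ; ends = λ { (f , _) → endsG G f }
  }

-- G / e : identify the two endpoints of e, delete e (parallel copies of e become loops)
contractEdge : (G : MGraph) → Fin (m G) → Gr
contractEdge G e =
  quot G (λ x → does (x ≟ proj₁ (endsG G e)) Data.Bool.∨ does (x ≟ proj₂ (endsG G e)))
         (λ f → not (does (f ≟ e)))

-- "w(e) is well defined and equals k"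
WeightIs : ℕ → (G : MGraph) → Fin (m G) → ℕ → Set
WeightIs δ G e k =
  (TwoConn (delete G e) → k ≡ 1) ×
  (TwoConn (contractEdge G e) → k ≡ δ ∸ 1) ×
  (TwoConn (delete G e) ⊎ TwoConn (contractEdge G e))

IsWeight : ℕ → (G : MGraph) → (Fin (m G) → ℕ) → Set
IsWeight δ G w = ∀ e → WeightIs δ G e (w e)

wE : (G : MGraph) → (Fin (m G) → ℕ) → Subset (n G) → ℕ
wE G w S = sumF (λ e → if inE G S e then w e else 0)

GoodFlat : (G : MGraph) → Subset (n G) → Set
GoodFlat G S =
  (∃[ x ] S x ≡ false) × TwoConn (induced G S) × TwoConn (contractSet G S)

Spade : ℕ → MGraph → Set
Spade δ G = Σ[ w ∈ (Fin (m G) → ℕ) ]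
  IsWeight δ G w ×
  (sumF w ≡ δ * (n G ∸ 1)) ×
  (∀ S → GoodFlat G S → wE G w S + 1 ≡ δ * (size S ∸ 1))

IsC2 : MGraph → Set
IsC2 G = (n G ≡ 2) × (m G ≡ 2) × LoopFree G

IsK4 : MGraph → Set
IsK4 G = (n G ≡ 4) × LoopFree G ×
  (∀ u v → u ≢ v →
     Σ[ e ∈ Fin (m G) ] (UEq (endsG G e) (u , v) ×
       (∀ f → UEq (endsG G f) (u , v) → f ≡ e)))

-- Construction A: H is (up to relabelling) obtained from G₁, G₂ by
-- gluing e₁ to e₂ and deleting the glued edge.

record ConstrA (δ : ℕ) (G₁ G₂ H : MGraph) : Set where
  field
    tc₁ : TwoConn (toGr G₁)
    tc₂ : TwoConn (toGr G₂)
    e₁  : Fin (m G₁)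
    e₂  : Fin (m G₂)
    w₁  : WeightIs δ G₁ e₁ 1
    w₂  : WeightIs δ G₂ e₂ (δ ∸ 1)
    φ₁  : Fin (n G₁) → Fin (n H)
    φ₂  : Fin (n G₂) → Fin (n H)
    φ₁-inj : ∀ x y → φ₁ x ≡ φ₁ y → x ≡ y
    φ₂-inj : ∀ x y → φ₂ x ≡ φ₂ y → x ≡ y
    cover  : ∀ z → (∃[ x ] φ₁ x ≡ z) ⊎ (∃[ y ] φ₂ y ≡ z)
    glue   : UEq (mapPair φ₁ (endsG G₁ e₁)) (mapPair φ₂ (endsG G₂ e₂))
    only-glue : ∀ x y → φ₁ x ≡ φ₂ y → (x ≡ proj₁ (endsG G₁ e₁)) ⊎ (x ≡ proj₂ (endsG G₁ e₁))
    ψ : ((Σ[ f ∈ Fin (m G₁) ] T (not (does (f ≟ e₁)))) ⊎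
         (Σ[ f ∈ Fin (m G₂) ] T (not (does (f ≟ e₂))))) ↔ Fin (m H)
    ψ-ends₁ : ∀ f → UEq (endsG H (Inverse.to ψ (inj₁ f))) (mapPair φ₁ (endsG G₁ (proj₁ f)))
    ψ-ends₂ : ∀ f → UEq (endsG H (Inverse.to ψ (inj₂ f))) (mapPair φ₂ (endsG G₂ (proj₁ f)))

data ClassA (δ : ℕ) : MGraph → Set where
  base : ∀ {G} → IsK4 G → ClassA δ G
  step : ∀ {G₁ G₂ H} → ClassA δ G₁ → ClassA δ G₂ → ConstrA δ G₁ G₂ H → ClassA δ H

{-# OPTIONS --safe #-}
-- Since 2-connectivity of G/E(S) amounts to connectedness of V ∖ S, the good flats S are the proper
-- 2-connected sets with connected complement, and (♠)₂ says that |E| = 2|V| − 2 and that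
-- |E(S)| = 2|S| − 3 for all of these. If the complement of a 2-connected set S falls apart, adding
-- either part to S keeps it 2-connected, so by induction |E(S)| ≤ 2|S| − 4. Splitting at cut
-- vertices, one finds that every proper S with |S| ≥ 2 is a good flat or has |E(S)| ≤ 2|S| − 4.
--
-- If G has no 2-vertex cut, every V ∖ {v} is a good flat, so all degrees are 3, |V| = 4 and G = K₄.
-- A 2-vertex cut {u , v} covers V by two sets meeting in {u , v}; counting forces both to be good
-- flats and u, v to be non-adjacent, and G arises by Construction A from the two sides, each with
-- an additional edge uv. A good flat of one side misses u or v and is a good flat of G, or it contains
-- both and becomes one after adding the other side. Conversely, every good flat of a glued graph
-- arises in this way from a good flat of one of the two graphs, so Construction A preserves (♠)₂.
module Submission where

open import Defs
open import Algebra.Bundles using (CommutativeMonoid)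
open import Data.Bool as 𝔹 using (Bool; true; false; not; _∧_; _∨_; T; if_then_else_)
open import Data.Bool.Properties
  using (T-≡; T-not-≡; T-irrelevant; not-¬; ¬-not; not-injective; ⇔→≡;
         ∧-comm; ∧-conicalˡ; ∧-conicalʳ; ∧-distribˡ-∨; ∧-identityʳ; ∧-zeroʳ; ∧-commutativeMonoid;
         ∨-comm; ∨-conicalˡ; ∨-conicalʳ; ∨-inverseˡ; ∨-zeroʳ)
open import Data.Empty using (⊥)
open import Data.Fin using (Fin; zero; suc; _≟_; punchIn; punchOut)
open import Data.Fin.Patterns
open import Data.Fin.Properties
  using (any?; all?; sequence; suc-injective; 0≢1+n; punchIn-injective; punchInᵢ≢i;
         punchIn-punchOut; punchOut-cong; punchOut-punchIn; +↔⊎; 0↔⊥; 1↔⊤)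
open import Data.Nat using (ℕ; zero; suc; _+_; _*_; _∸_; _≤_; _<_; z≤n; s≤s)
open import Data.Nat.Induction using (<-wellFounded)
open import Data.Nat.Properties hiding (_≟_; 0≢1+n; suc-injective)
open import Data.Nat.Tactic.RingSolver using (solve-∀)
open import Data.Product as Product using (Σ-syntax; ∃; ∃-syntax; _×_; _,_; proj₁; proj₂; map₂)
open import Data.Sum as Sum using (_⊎_; inj₁; inj₂; [_,_]; [_,_]′; swap; map₁)
import Data.Sum.Effectful.Left as Left
open import Data.Sum.Function.Propositional using (_⊎-↔_)
open import Data.Sum.Properties using (inj₁-injective; inj₂-injective; swap-involutive)
open import Data.Unit using (⊤; tt)
open import Function using (_∘_; id)
open import Function.Bundles using (Equivalence; Injection; Inverse; _⇔_; _↔_; mk⇔; mk↔ₛ′)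
open import Function.Construct.Composition using (_⇔-∘_; _↔-∘_)
open import Function.Construct.Symmetry using (↔-sym)
open import Function.Definitions using (Injective)
open import Function.Properties.Inverse using (↔⇒↣)
open import Induction.WellFounded using (Acc; acc)
open import Level using (0ℓ)
open import Relation.Binary using (Rel; Symmetric) renaming (Decidable to Decidable₂)
open import Relation.Binary.Construct.Closure.ReflexiveTransitive
  using (Star; ε; _◅_; _◅◅_; fold; kleisliStar; return)
open import Relation.Binary.Construct.Closure.ReflexiveTransitive.Properties using (reflexive)
open import Relation.Binary.PropositionalEquality
  using (_≡_; _≢_; _≗_; refl; sym; trans; cong; cong₂; subst; subst₂; module ≡-Reasoning)
open import Relation.Nullary using (¬_; Dec; yes; no; does; contradiction)
open import Relation.Nullary.Decidable
  using (dec-true; dec-false; decidable-stable; does-⇔; from-yes; map′; ¬?;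
         _×-dec_; _⊎-dec_; _→-dec_)
open import Relation.Unary using (Pred; Decidable; _≐_)

open import Algebra.Properties.CommutativeMonoid.Sum +-0-commutativeMonoid
  using (sum; sum-remove; ∑-comm; ∑-distrib-+)
open import Algebra.Properties.CommutativeSemigroup +-commutativeSemigroup
  using (xy∙z≈xz∙y) renaming (interchange to +-interchange)
open import Algebra.Properties.CommutativeSemigroup
  (CommutativeMonoid.commutativeSemigroup ∧-commutativeMonoid)
  using () renaming (interchange to ∧-interchange)

private variable
  k l r : ℕ
  A B : Set
  G G₁ G₂ H : MGraph

-- Sets of vertices or edges

infix 4 _∈_ _∉_ _∈?_ _∉?_ _⊆_ _≢?_
_∈_ _∉_ : A → (A → Bool) → Set
x ∈ S = S x ≡ true
x ∉ S = S x ≡ false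

_⊆_ : (A → Bool) → (A → Bool) → Set
S ⊆ S′ = ∀ x → x ∈ S → x ∈ S′

∈⊎∉ : (S : A → Bool) (x : A) → x ∈ S ⊎ x ∉ S
∈⊎∉ S x with S x
... | true  = inj₁ refl
... | false = inj₂ refl

_∈?_ : (x : A) (S : A → Bool) → Dec (x ∈ S)
x ∈? S = S x 𝔹.≟ true

_∉?_ : (x : A) (S : A → Bool) → Dec (x ∉ S)
x ∉? S = S x 𝔹.≟ false

∈⇒T : {b : Bool} → b ≡ true → T b
∈⇒T = Equivalence.from T-≡

T⇒∈ : {b : Bool} → T b → b ≡ true
T⇒∈ = Equivalence.to T-≡

∉⇒T : {b : Bool} → b ≡ false → T (not b)
∉⇒T = Equivalence.from T-not-≡

T⇒∉ : {b : Bool} → T (not b) → b ≡ false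
T⇒∉ = Equivalence.to T-not-≡

∈∉⇒≢ : {S : A → Bool} {x y : A} → x ∈ S → y ∉ S → x ≢ y
∈∉⇒≢ x∈S y∉S refl = not-¬ x∈S y∉S

_≢?_ : (x y : Fin k) → Dec (x ≢ y)
x ≢? y = ¬? (x ≟ y)

∧-true⁻ : ∀ a b → a ∧ b ≡ true → a ≡ true × b ≡ true
∧-true⁻ true true _ = refl , refl

∨-true⁻ : ∀ a b → a ∨ b ≡ true → a ≡ true ⊎ b ≡ true
∨-true⁻ true  b _  = inj₁ refl
∨-true⁻ false b eq = inj₂ eq

infixr 7 _∩_
infixr 6 _∪_
_∩_ _∪_ : Subset k → Subset k → Subset k
(S ∩ S′) x = S x ∧ S′ x
(S ∪ S′) x = S x ∨ S′ x

∁ : Subset k → Subset k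
∁ S = not ∘ S

full ∅ : Subset k
full _ = true
∅    _ = false

S⊆S∪S′ : (S S′ : Subset k) → S ⊆ S ∪ S′
S⊆S∪S′ S S′ x x∈S = cong (_∨ S′ x) x∈S

S′⊆S∪S′ : (S S′ : Subset k) → S′ ⊆ S ∪ S′
S′⊆S∪S′ S S′ x x∈S′ = trans (cong (S x ∨_) x∈S′) (∨-zeroʳ (S x))

⁅_⁆ : Fin k → Subset k
⁅ i ⁆ j = does (j ≟ i)

pair : Fin k → Fin k → Subset k
pair i j = ⁅ i ⁆ ∪ ⁅ j ⁆

x∈⁅x⁆ : (x : Fin k) → x ∈ ⁅ x ⁆
x∈⁅x⁆ x = dec-true (x ≟ x) refl

x≢y⇒x∉⁅y⁆ : {x y : Fin k} → x ≢ y → x ∉ ⁅ y ⁆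
x≢y⇒x∉⁅y⁆ {x = x} {y} = dec-false (x ≟ y)

x∈⁅y⁆⇒x≡y : {x y : Fin k} → x ∈ ⁅ y ⁆ → x ≡ y
x∈⁅y⁆⇒x≡y {x = x} {y} x∈ with x ≟ y
... | yes x≡y = x≡y
x∈⁅y⁆⇒x≡y () | no _

x∉⁅y⁆⇒x≢y : {x y : Fin k} → x ∉ ⁅ y ⁆ → x ≢ y
x∉⁅y⁆⇒x≢y {x = x} x∉ refl = not-¬ (x∈⁅x⁆ x) x∉

⁅x⁆⊆ : (S : Subset k) {x : Fin k} → x ∈ S → ⁅ x ⁆ ⊆ S
⁅x⁆⊆ S x∈S y y∈x = subst (_∈ S) (sym (x∈⁅y⁆⇒x≡y y∈x)) x∈S

pair⊆ : (S : Subset k) {x y : Fin k} → x ∈ S → y ∈ S → pair x y ⊆ S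
pair⊆ S x∈S y∈S z z∈ = [ ⁅x⁆⊆ S x∈S z , ⁅x⁆⊆ S y∈S z ] (∨-true⁻ _ _ z∈)

x∈pair-xy : (x y : Fin k) → x ∈ pair x y
x∈pair-xy x y = S⊆S∪S′ ⁅ x ⁆ ⁅ y ⁆ x (x∈⁅x⁆ x)

y∈pair-xy : (x y : Fin k) → y ∈ pair x y
y∈pair-xy x y = S′⊆S∪S′ ⁅ x ⁆ ⁅ y ⁆ y (x∈⁅x⁆ y)

z∈pair-xy⇒z≡x⊎z≡y : {x y z : Fin k} → z ∈ pair x y → z ≡ x ⊎ z ≡ y
z∈pair-xy⇒z≡x⊎z≡y z∈ = Sum.map x∈⁅y⁆⇒x≡y x∈⁅y⁆⇒x≡y (∨-true⁻ _ _ z∈)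

z∉pair-xy⇒z≢x×z≢y : {x y z : Fin k} → z ∉ pair x y → z ≢ x × z ≢ y
z∉pair-xy⇒z≢x×z≢y z∉ = x∉⁅y⁆⇒x≢y (∨-conicalˡ _ _ z∉) , x∉⁅y⁆⇒x≢y (∨-conicalʳ _ _ z∉)

z≢x⇒z≢y⇒z∉pair-xy : {x y z : Fin k} → z ≢ x → z ≢ y → z ∉ pair x y
z≢x⇒z≢y⇒z∉pair-xy z≢x z≢y = cong₂ _∨_ (x≢y⇒x∉⁅y⁆ z≢x) (x≢y⇒x∉⁅y⁆ z≢y)

Proper AtLeastTwo : Subset k → Set
Proper S     = ∃[ x ] x ∉ S
AtLeastTwo S = ∃[ x ] ∃[ y ] (x ≢ y × x ∈ S × y ∈ S)

proper-⊆ : {S S′ : Subset k} → S ⊆ S′ → Proper S′ → Proper S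
proper-⊆ S⊆S′ (x , x∉S′) = x , ¬-not λ x∈S → not-¬ (S⊆S′ x x∈S) x∉S′

atLeastTwo-⊆ : {S S′ : Subset k} → S ⊆ S′ → AtLeastTwo S → AtLeastTwo S′
atLeastTwo-⊆ S⊆S′ (x , y , x≢y , x∈S , y∈S) = x , y , x≢y , S⊆S′ x x∈S , S⊆S′ y y∈S

another : 2 ≤ k → (x : Fin k) → ∃[ y ] y ≢ x
another (s≤s (s≤s _)) x = punchIn x 0F , punchInᵢ≢i x 0F

two-others : 3 ≤ k → (x : Fin k) → ∃[ y ] ∃[ z ] (y ≢ z × y ≢ x × z ≢ x)
two-others (s≤s (s≤s (s≤s _))) x = punchIn x 0F , punchIn x 1F
  , 0≢1+n ∘ punchIn-injective x 0F 1F , punchInᵢ≢i x 0F , punchInᵢ≢i x 1F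

any⊎all : {P Q : Pred (Fin k) 0ℓ} → (∀ x → P x ⊎ Q x) → ∃ P ⊎ (∀ x → Q x)
any⊎all {P = P} f = sequence (Left.applicative (∃ P) 0ℓ) (λ x → map₁ (x ,_) (f x))

image : (Fin k → Fin l) → Subset l
image φ z = does (any? λ x → z ≟ φ x)

∈-image⁺ : (φ : Fin k → Fin l) (x : Fin k) → φ x ∈ image φ
∈-image⁺ φ x = dec-true (any? λ y → φ x ≟ φ y) (x , refl)

∈-image⁻ : {φ : Fin k → Fin l} {z : Fin l} → z ∈ image φ → ∃[ x ] φ x ≡ z
∈-image⁻ {φ = φ} {z} z∈ with any? (λ x → z ≟ φ x)
... | yes (x , z≡φx) = x , sym z≡φx
∈-image⁻ () | no _

-- Finite sums and cardinalities

sumF≡sum : (f : Fin k → ℕ) → sumF f ≡ sum f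
sumF≡sum {zero}  f = refl
sumF≡sum {suc k} f = cong (f zero +_) (sumF≡sum (f ∘ suc))

sumF-cong : {f g : Fin k → ℕ} → f ≗ g → sumF f ≡ sumF g
sumF-cong {zero}  f≗g = refl
sumF-cong {suc k} f≗g = cong₂ _+_ (f≗g zero) (sumF-cong (f≗g ∘ suc))

sumF-const : ∀ k c → sumF {k} (λ _ → c) ≡ k * c
sumF-const zero    c = refl
sumF-const (suc k) c = cong (c +_) (sumF-const k c)

sumF-mono-≤ : {f g : Fin k → ℕ} → (∀ i → f i ≤ g i) → sumF f ≤ sumF g
sumF-mono-≤ {zero}  f≤g = z≤n
sumF-mono-≤ {suc k} f≤g = +-mono-≤ (f≤g zero) (sumF-mono-≤ (f≤g ∘ suc))

sumF-distrib-+ : (f g : Fin k → ℕ) → sumF (λ i → f i + g i) ≡ sumF f + sumF g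
sumF-distrib-+ f g = begin
  sumF (λ i → f i + g i) ≡⟨ sumF≡sum (λ i → f i + g i) ⟩
  sum (λ i → f i + g i)  ≡⟨ ∑-distrib-+ f g ⟩
  sum f + sum g          ≡⟨ cong₂ _+_ (sumF≡sum f) (sumF≡sum g) ⟨
  sumF f + sumF g        ∎
  where open ≡-Reasoning

sumF-comm : (f : Fin k → Fin l → ℕ) →
  sumF (λ i → sumF (f i)) ≡ sumF (λ j → sumF (λ i → f i j))
sumF-comm f = begin
  sumF (λ i → sumF (f i))          ≡⟨ sumF-cong (sumF≡sum ∘ f) ⟩
  sumF (λ i → sum (f i))           ≡⟨ sumF≡sum (sum ∘ f) ⟩
  sum (λ i → sum (f i))            ≡⟨ ∑-comm f ⟩
  sum (λ j → sum (λ i → f i j))    ≡⟨ sumF≡sum (λ j → sum (λ i → f i j)) ⟨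
  sumF (λ j → sum (λ i → f i j))   ≡⟨ sumF-cong (λ j → sumF≡sum (λ i → f i j)) ⟨
  sumF (λ j → sumF (λ i → f i j))  ∎
  where open ≡-Reasoning

𝟙 : Bool → ℕ
𝟙 b = if b then 1 else 0

size-cong : {S S′ : Subset k} → S ≗ S′ → size S ≡ size S′
size-cong S≗S′ = sumF-cong (cong 𝟙 ∘ S≗S′)

size-full : size (full {k}) ≡ k
size-full {k} = trans (sumF-const k 1) (*-identityʳ k)

size-universal : {S : Subset k} → (∀ x → x ∈ S) → size S ≡ k
size-universal universal = trans (size-cong universal) size-full

size-empty : {S : Subset k} → (∀ x → x ∉ S) → size S ≡ 0
size-empty {k} empty = trans (size-cong empty) (trans (sumF-const k 0) (*-zeroʳ k))

size-mono-≤ : (S S′ : Subset k) → S ⊆ S′ → size S ≤ size S′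
size-mono-≤ S S′ S⊆S′ = sumF-mono-≤ λ x → 𝟙-mono (S x) (S′ x) (S⊆S′ x)
  where
  𝟙-mono : ∀ a b → (a ≡ true → b ≡ true) → 𝟙 a ≤ 𝟙 b
  𝟙-mono false b     _   = z≤n
  𝟙-mono true  true  _   = ≤-refl
  𝟙-mono true  false a⇒b = contradiction (a⇒b refl) λ ()

size-∪-∩ : (S S′ : Subset k) → size (S ∪ S′) + size (S ∩ S′) ≡ size S + size S′
size-∪-∩ S S′ = begin
  size (S ∪ S′) + size (S ∩ S′)                 ≡⟨ sumF-distrib-+ (𝟙 ∘ (S ∪ S′)) (𝟙 ∘ (S ∩ S′)) ⟨
  sumF (λ x → 𝟙 (S x ∨ S′ x) + 𝟙 (S x ∧ S′ x))  ≡⟨ sumF-cong (λ x → 𝟙-∨-∧ (S x) (S′ x)) ⟩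
  sumF (λ x → 𝟙 (S x) + 𝟙 (S′ x))               ≡⟨ sumF-distrib-+ (𝟙 ∘ S) (𝟙 ∘ S′) ⟩
  size S + size S′                              ∎
  where
  open ≡-Reasoning
  𝟙-∨-∧ : ∀ a b → 𝟙 (a ∨ b) + 𝟙 (a ∧ b) ≡ 𝟙 a + 𝟙 b
  𝟙-∨-∧ true  b = refl
  𝟙-∨-∧ false b = +-identityʳ (𝟙 b)

size-disjoint-∪ : (S S′ : Subset k) → (∀ x → x ∈ S → x ∉ S′) → size (S ∪ S′) ≡ size S + size S′
size-disjoint-∪ S S′ disjoint = begin
  size (S ∪ S′)                  ≡⟨ +-identityʳ _ ⟨
  size (S ∪ S′) + 0              ≡⟨ cong (size (S ∪ S′) +_) (size-empty S∩S′-empty) ⟨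
  size (S ∪ S′) + size (S ∩ S′)  ≡⟨ size-∪-∩ S S′ ⟩
  size S + size S′               ∎
  where
  open ≡-Reasoning
  S∩S′-empty : ∀ x → x ∉ S ∩ S′
  S∩S′-empty x with ∈⊎∉ S x
  ... | inj₁ x∈S = cong₂ _∧_ x∈S (disjoint x x∈S)
  ... | inj₂ x∉S = cong (_∧ S′ x) x∉S

size-punchIn : (S : Subset (suc k)) (i : Fin (suc k)) → size S ≡ 𝟙 (S i) + size (S ∘ punchIn i)
size-punchIn S i = begin
  size S                             ≡⟨ sumF≡sum (𝟙 ∘ S) ⟩
  sum (𝟙 ∘ S)                        ≡⟨ sum-remove {i = i} (𝟙 ∘ S) ⟩
  𝟙 (S i) + sum (𝟙 ∘ S ∘ punchIn i)  ≡⟨ cong (𝟙 (S i) +_) (sumF≡sum (𝟙 ∘ S ∘ punchIn i)) ⟨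
  𝟙 (S i) + size (S ∘ punchIn i)     ∎
  where open ≡-Reasoning

size-∩-⁅⁆ : (S : Subset k) (x : Fin k) → size (S ∩ ⁅ x ⁆) ≡ 𝟙 (S x)
size-∩-⁅⁆ {suc k} S x = begin
  size (S ∩ ⁅ x ⁆)                                    ≡⟨ size-punchIn (S ∩ ⁅ x ⁆) x ⟩
  𝟙 (S x ∧ ⁅ x ⁆ x) + size ((S ∩ ⁅ x ⁆) ∘ punchIn x)  ≡⟨ cong₂ _+_ (cong 𝟙 at-x)
                                                           (size-empty off-x) ⟩
  𝟙 (S x) + 0                                         ≡⟨ +-identityʳ _ ⟩
  𝟙 (S x)                                             ∎
  where
  open ≡-Reasoning
  at-x : S x ∧ ⁅ x ⁆ x ≡ S x
  at-x = trans (cong (S x ∧_) (x∈⁅x⁆ x)) (∧-identityʳ (S x))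
  off-x : ∀ i → punchIn x i ∉ S ∩ ⁅ x ⁆
  off-x i = trans (cong (S (punchIn x i) ∧_) (x≢y⇒x∉⁅y⁆ (punchInᵢ≢i x i))) (∧-zeroʳ _)

size-⁅⁆ : (x : Fin k) → size ⁅ x ⁆ ≡ 1
size-⁅⁆ = size-∩-⁅⁆ full

size-pair : {x y : Fin k} → x ≢ y → size (pair x y) ≡ 2
size-pair {x = x} {y} x≢y = trans
  (size-disjoint-∪ ⁅ x ⁆ ⁅ y ⁆ λ z z∈x → x≢y⇒x∉⁅y⁆ {x = z} (x≢y ∘ trans (sym (x∈⁅y⁆⇒x≡y z∈x))))
  (cong₂ _+_ (size-⁅⁆ x) (size-⁅⁆ y))

size-∁⁅⁆ : (x : Fin k) → size (∁ ⁅ x ⁆) + 1 ≡ k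
size-∁⁅⁆ {k} x = begin
  size (∁ ⁅ x ⁆) + 1           ≡⟨ cong (size (∁ ⁅ x ⁆) +_) (size-⁅⁆ x) ⟨
  size (∁ ⁅ x ⁆) + size ⁅ x ⁆  ≡⟨ size-disjoint-∪ (∁ ⁅ x ⁆) ⁅ x ⁆ (λ _ → not-injective) ⟨
  size (∁ ⁅ x ⁆ ∪ ⁅ x ⁆)       ≡⟨ size-universal (λ y → ∨-inverseˡ (⁅ x ⁆ y)) ⟩
  k                            ∎
  where open ≡-Reasoning

size-mono-< : (S S′ : Subset k) → S ⊆ S′ → {x : Fin k} → x ∉ S → x ∈ S′ → size S < size S′
size-mono-< S S′ S⊆S′ {x} x∉S x∈S′ = begin-strict
  size S               <⟨ n<1+n _ ⟩
  1 + size S           ≡⟨ cong (_+ size S) (size-⁅⁆ x) ⟨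
  size ⁅ x ⁆ + size S  ≡⟨ size-disjoint-∪ ⁅ x ⁆ S ⁅x⁆-disjoint-S ⟨
  size (⁅ x ⁆ ∪ S)     ≤⟨ size-mono-≤ (⁅ x ⁆ ∪ S) S′ ⁅x⁆∪S⊆S′ ⟩
  size S′              ∎
  where
  open ≤-Reasoning
  ⁅x⁆-disjoint-S : ∀ y → y ∈ ⁅ x ⁆ → y ∉ S
  ⁅x⁆-disjoint-S y y∈x = not-injective (⁅x⁆⊆ (∁ S) (cong not x∉S) y y∈x)
  ⁅x⁆∪S⊆S′ : ⁅ x ⁆ ∪ S ⊆ S′
  ⁅x⁆∪S⊆S′ y = [ ⁅x⁆⊆ S′ x∈S′ y , S⊆S′ y ]′ ∘ ∨-true⁻ _ _

size-∁-anti-< : (S S′ : Subset k) → S ⊆ S′ → {x : Fin k} → x ∉ S → x ∈ S′ → size (∁ S′) < size (∁ S)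
size-∁-anti-< S S′ S⊆S′ x∉S x∈S′ = size-mono-< (∁ S′) (∁ S)
  (λ y y∉S′ → cong not (¬-not λ y∈S → not-¬ (S⊆S′ y y∈S) (not-injective y∉S′)))
  (cong not x∈S′) (cong not x∉S)

nonempty⇒1≤size : (S : Subset k) → ∃ (_∈ S) → 1 ≤ size S
nonempty⇒1≤size S (x , x∈S) = subst (_≤ size S) (size-⁅⁆ x) (size-mono-≤ ⁅ x ⁆ S (⁅x⁆⊆ S x∈S))

atLeastTwo⇒2≤size : (S : Subset k) → AtLeastTwo S → 2 ≤ size S
atLeastTwo⇒2≤size S (x , y , x≢y , x∈S , y∈S) = subst (_≤ size S) (size-pair x≢y)
  (size-mono-≤ (pair x y) S (pair⊆ S x∈S y∈S))

size-∘-injective : {φ : Fin k → Fin l} → Injective _≡_ _≡_ φ → (S : Subset l) →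
  size (S ∘ φ) ≡ size (S ∩ image φ)
size-∘-injective {zero}  {φ = φ} inj S = sym (size-empty λ z → ∧-zeroʳ (S z))
size-∘-injective {suc k} {φ = φ} inj S = begin
  𝟙 (S (φ zero)) + size (S ∘ φ ∘ suc)
    ≡⟨ cong₂ _+_ (sym (size-∩-⁅⁆ S (φ zero))) (size-∘-injective (suc-injective ∘ inj) S) ⟩
  size (S ∩ ⁅ φ zero ⁆) + size (S ∩ image (φ ∘ suc))
    ≡⟨ size-disjoint-∪ (S ∩ ⁅ φ zero ⁆) (S ∩ image (φ ∘ suc)) disjoint ⟨
  size ((S ∩ ⁅ φ zero ⁆) ∪ (S ∩ image (φ ∘ suc)))
    ≡⟨ size-cong (λ z → ∧-distribˡ-∨ (S z) (⁅ φ zero ⁆ z) (image (φ ∘ suc) z)) ⟨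
  size (S ∩ image φ) ∎
  where
  open ≡-Reasoning
  disjoint : ∀ z → z ∈ S ∩ ⁅ φ zero ⁆ → z ∉ S ∩ image (φ ∘ suc)
  disjoint z z∈ˡ = ¬-not λ z∈ʳ →
    let x , φ[1+x]≡z = ∈-image⁻ {φ = φ ∘ suc} {z} (∧-conicalʳ (S z) _ z∈ʳ)
        z≡φ0         = x∈⁅y⁆⇒x≡y (∧-conicalʳ (S z) _ z∈ˡ)
    in 0≢1+n (inj (sym (trans φ[1+x]≡z z≡φ0)))

size-∘-bijective : {φ : Fin k → Fin l} → Injective _≡_ _≡_ φ → (∀ z → z ∈ image φ) →
  (S : Subset l) → size (S ∘ φ) ≡ size S
size-∘-bijective {φ = φ} inj surj S = trans (size-∘-injective inj S)
  (size-cong λ z → trans (cong (S z ∧_) (surj z)) (∧-identityʳ (S z)))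

size-cover : {φ : Fin k → Fin r} {ψ : Fin l → Fin r} → Injective _≡_ _≡_ φ → Injective _≡_ _≡_ ψ →
  (∀ z → z ∈ image φ ∪ image ψ) → (S : Subset r) →
  size S + size (S ∩ (image φ ∩ image ψ)) ≡ size (S ∘ φ) + size (S ∘ ψ)
size-cover {φ = φ} {ψ} φ-inj ψ-inj cover S = begin
  size S + size (S ∩ (image φ ∩ image ψ))
    ≡⟨ cong₂ _+_ (size-cong union) (size-cong inter) ⟩
  size ((S ∩ image φ) ∪ (S ∩ image ψ)) + size ((S ∩ image φ) ∩ (S ∩ image ψ))
    ≡⟨ size-∪-∩ (S ∩ image φ) (S ∩ image ψ) ⟩
  size (S ∩ image φ) + size (S ∩ image ψ)
    ≡⟨ cong₂ _+_ (size-∘-injective φ-inj S) (size-∘-injective ψ-inj S) ⟨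
  size (S ∘ φ) + size (S ∘ ψ) ∎
  where
  open ≡-Reasoning
  union : S ≗ (S ∩ image φ) ∪ (S ∩ image ψ)
  union z = trans (sym (∧-identityʳ (S z)))
    (trans (cong (S z ∧_) (sym (cover z))) (∧-distribˡ-∨ (S z) (image φ z) (image ψ z)))
  inter : S ∩ (image φ ∩ image ψ) ≗ (S ∩ image φ) ∩ (S ∩ image ψ)
  inter z with S z
  ... | true  = refl
  ... | false = refl

-- Connectedness

module _ (_~_ : Rel A 0ℓ) (P : Pred A 0ℓ) where

  Monochromatic : (A → Bool) → Set
  Monochromatic c = ∀ {x y} → x ~ y → P x → P y → c x ≡ c y

  -- By 2-colourings and not by walks, because colourings can be pulled back along any map of
  -- vertices.
  Connected : Set
  Connected = ∀ c → Monochromatic c → ∀ {x y} → P x → P y → c x ≡ c y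

  record Cut : Set where
    field
      colour        : A → Bool
      monochromatic : Monochromatic colour
      {x y}         : A
      Px            : P x
      Py            : P y
      x∈colour      : x ∈ colour
      y∉colour      : y ∉ colour

  Walk : Rel A 0ℓ
  Walk = Star λ x y → P x × P y × x ~ y

module _ {_~_ : Rel A 0ℓ} {P : Pred A 0ℓ} where

  walk-monochromatic : ∀ {c} → Monochromatic _~_ P c → ∀ {x y} → Walk _~_ P x y → c x ≡ c y
  walk-monochromatic {c} mono =
    fold (λ x y → c x ≡ c y) (λ (Px , Py , x~y) → trans (mono x~y Px Py)) refl

  connected-resp-≐ : ∀ {Q} → P ≐ Q → Connected _~_ P → Connected _~_ Q
  connected-resp-≐ (P⊆Q , Q⊆P) connected c mono Qx Qy =
    connected c (λ x~y Px Py → mono x~y (P⊆Q Px) (P⊆Q Py)) (Q⊆P Qx) (Q⊆P Qy)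

  connected-subsingleton : (∀ {x y} → P x → P y → x ≡ y) → Connected _~_ P
  connected-subsingleton unique c _ Px Py = cong c (unique Px Py)

  cut-resp-≐ : ∀ {Q} → P ≐ Q → Cut _~_ P → Cut _~_ Q
  cut-resp-≐ (P⊆Q , Q⊆P) cut = record
    { colour = colour ; monochromatic = λ x~y Qx Qy → monochromatic x~y (Q⊆P Qx) (Q⊆P Qy)
    ; Px = P⊆Q Px ; Py = P⊆Q Py ; x∈colour = x∈colour ; y∉colour = y∉colour }
    where open Cut cut

  cut⇒¬connected : Cut _~_ P → ¬ Connected _~_ P
  cut⇒¬connected cut connected =
    not-¬ x∈colour (trans (connected colour monochromatic Px Py) y∉colour)
    where open Cut cut

  flip-cut : Cut _~_ P → Cut _~_ P
  flip-cut cut = record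
    { colour = not ∘ colour ; monochromatic = λ x~y Px Py → cong not (monochromatic x~y Px Py)
    ; Px = Py ; Py = Px ; x∈colour = cong not y∉colour ; y∉colour = cong not x∈colour }
    where open Cut cut

module _ (S d : A → Bool) (b : Bool) where

  recolour : A → Bool
  recolour x = if S x then d x else b

  recolour-∈ : ∀ {x} → x ∈ S → recolour x ≡ d x
  recolour-∈ = cong (if_then _ else b)

  recolour-∉ : ∀ {x} → x ∉ S → recolour x ≡ b
  recolour-∉ = cong (if_then _ else b)

  recolour-monochromatic : {_~_ : Rel A 0ℓ} {P : Pred A 0ℓ} → Symmetric _~_ →
    Monochromatic _~_ (λ x → P x × x ∈ S) d →
    (∀ {x y} → x ~ y → P x → P y → x ∈ S → y ∉ S → d x ≡ b) →
    Monochromatic _~_ P recolour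
  recolour-monochromatic ~-sym inside boundary {x} {y} x~y Px Py with ∈⊎∉ S x | ∈⊎∉ S y
  ... | inj₁ x∈S | inj₁ y∈S =
    trans (recolour-∈ x∈S) (trans (inside x~y (Px , x∈S) (Py , y∈S)) (sym (recolour-∈ y∈S)))
  ... | inj₁ x∈S | inj₂ y∉S =
    trans (recolour-∈ x∈S) (trans (boundary x~y Px Py x∈S y∉S) (sym (recolour-∉ y∉S)))
  ... | inj₂ x∉S | inj₁ y∈S =
    trans (recolour-∉ x∉S) (sym (trans (recolour-∈ y∈S) (boundary (~-sym x~y) Py Px y∈S x∉S)))
  ... | inj₂ x∉S | inj₂ y∉S = trans (recolour-∉ x∉S) (sym (recolour-∉ y∉S))

extend : (Fin k → Fin l) → Subset k → Bool → Subset l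
extend φ d b z with any? (λ x → z ≟ φ x)
... | yes (x , _) = d x
... | no _        = b

extend-∘ : {φ : Fin k → Fin l} → Injective _≡_ _≡_ φ → ∀ d b → extend φ d b ∘ φ ≗ d
extend-∘ {φ = φ} φ-inj d b x with any? (λ x′ → φ x ≟ φ x′)
... | yes (x′ , eq) = cong d (φ-inj (sym eq))
... | no none       = contradiction (x , refl) none

extend-const : (φ : Fin k → Fin l) → ∀ d b z → (∀ x → z ≡ φ x → d x ≡ b) → extend φ d b z ≡ b
extend-const φ d b z agree with any? (λ x → z ≟ φ x)
... | yes (x , eq) = agree x eq
... | no _         = refl

extend-false⊆image : (φ : Fin k → Fin l) → ∀ d → extend φ d false ⊆ image φ
extend-false⊆image φ d z z∈ = ¬-not λ z∉ → not-¬ z∈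
  (extend-const φ d false z λ { x refl → contradiction (∈-image⁺ φ x) (not-¬ z∉) })

module _ {_~_ : Rel (Fin k) 0ℓ} (~-sym : Symmetric _~_) (_~?_ : Decidable₂ _~_)
  {P : Pred (Fin k) 0ℓ} (P? : Decidable P) where

  record Component (x : Fin k) : Set where
    constructor component-of
    field
      members       : Subset k
      start∈        : x ∈ members
      monochromatic : Monochromatic _~_ P members
      reached       : ∀ y → y ∈ members → P y × Walk _~_ P x y

  component : ∀ {x} → P x → Component x
  component {x} Px =
    grow ⁅ x ⁆ (x∈⁅x⁆ x) (λ y y∈x → at-x (x∈⁅y⁆⇒x≡y y∈x)) (<-wellFounded _)
    where
    Reached : Pred (Fin k) 0ℓ
    Reached y = P y × Walk _~_ P x y

    at-x : ∀ {y} → y ≡ x → Reached y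
    at-x refl = Px , ε

    grow : ∀ R → x ∈ R → (∀ y → y ∈ R → Reached y) → Acc _<_ (size (∁ R)) → Component x
    grow R x∈R reached (acc rec)
      with any? (λ y → any? λ z → (y ∈? R) ×-dec (z ∉? R) ×-dec P? z ×-dec (y ~? z))
    ... | no closed = component-of R x∈R mono reached
      where
      mono : Monochromatic _~_ P R
      mono {y} {z} y~z Py Pz with ∈⊎∉ R y | ∈⊎∉ R z
      ... | inj₁ y∈R | inj₁ z∈R = trans y∈R (sym z∈R)
      ... | inj₂ y∉R | inj₂ z∉R = trans y∉R (sym z∉R)
      ... | inj₁ y∈R | inj₂ z∉R = contradiction (y , z , y∈R , z∉R , Pz , y~z) closed
      ... | inj₂ y∉R | inj₁ z∈R = contradiction (z , y , z∈R , y∉R , Py , ~-sym y~z) closed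
    ... | yes (y , z , y∈R , z∉R , Pz , y~z) =
      grow (R ∪ ⁅ z ⁆) (S⊆S∪S′ R ⁅ z ⁆ x x∈R)
        (λ w w∈ → [ reached w , at-z ∘ x∈⁅y⁆⇒x≡y ] (∨-true⁻ (R w) _ w∈)) (rec
          (size-∁-anti-< R (R ∪ ⁅ z ⁆) (S⊆S∪S′ R ⁅ z ⁆) z∉R (S′⊆S∪S′ R ⁅ z ⁆ z (x∈⁅x⁆ z))))
      where
      at-z : ∀ {w} → w ≡ z → Reached w
      at-z refl = let Py , walk = reached y y∈R in Pz , walk ◅◅ return (Py , Pz , y~z)

  connected⇒walks : Connected _~_ P → ∀ x y → P x → P y → Walk _~_ P x y
  connected⇒walks connected x y Px Py =
    proj₂ (reached y (trans (sym (connected members monochromatic Px Py)) start∈))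
    where open Component (component Px)

  connected⊎cut : Connected _~_ P ⊎ Cut _~_ P
  connected⊎cut with any? P?
  ... | no empty = inj₁ λ _ _ Px → contradiction (_ , Px) empty
  ... | yes (x , Px) = decide (any? λ y → P? y ×-dec (y ∉? members))
    where
    open Component (component Px)
    decide : Dec (∃[ y ] P y × y ∉ members) → Connected _~_ P ⊎ Cut _~_ P
    decide (yes (y , Py , y∉)) = inj₂ record
      { colour = members ; monochromatic = monochromatic
      ; Px = Px ; Py = Py ; x∈colour = start∈ ; y∉colour = y∉ }
    decide (no none) = inj₁ λ c mono Py Pz → trans (sym (from-x mono Py)) (from-x mono Pz)
      where
      from-x : ∀ {c} → Monochromatic _~_ P c → ∀ {y} → P y → c x ≡ c y
      from-x mono {y} Py = walk-monochromatic mono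
        (proj₂ (reached y (¬-not λ y∉ → none (y , Py , y∉))))

-- Graphs

uEq-sym : {a b : A × A} → UEq a b → UEq b a
uEq-sym (inj₁ (refl , refl)) = inj₁ (refl , refl)
uEq-sym (inj₂ (refl , refl)) = inj₂ (refl , refl)

uEq-trans : {a b c : A × A} → UEq a b → UEq b c → UEq a c
uEq-trans (inj₁ (refl , refl)) q = q
uEq-trans (inj₂ (refl , refl)) (inj₁ (refl , refl)) = inj₂ (refl , refl)
uEq-trans (inj₂ (refl , refl)) (inj₂ (refl , refl)) = inj₁ (refl , refl)

uEq-∧ : (S : A → Bool) {a b : A × A} → UEq a b →
  S (proj₁ a) ∧ S (proj₂ a) ≡ S (proj₁ b) ∧ S (proj₂ b)
uEq-∧ S (inj₁ (refl , refl)) = refl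
uEq-∧ S (inj₂ (refl , refl)) = ∧-comm (S _) (S _)

uEq-∈ : {a b : A × A} → UEq a b → ∀ {z} → z ≡ proj₁ a ⊎ z ≡ proj₂ a → z ≡ proj₁ b ⊎ z ≡ proj₂ b
uEq-∈ (inj₁ (refl , refl)) = id
uEq-∈ (inj₂ (refl , refl)) = swap

mapPair-uEq⁺ : (φ : A → B) {a b : A × A} → UEq a b → UEq (mapPair φ a) (mapPair φ b)
mapPair-uEq⁺ φ (inj₁ (refl , refl)) = inj₁ (refl , refl)
mapPair-uEq⁺ φ (inj₂ (refl , refl)) = inj₂ (refl , refl)

mapPair-uEq⁻ : {φ : A → B} → Injective _≡_ _≡_ φ →
  {a b : A × A} → UEq (mapPair φ a) (mapPair φ b) → UEq a b
mapPair-uEq⁻ φ-inj (inj₁ (p , q)) = inj₁ (φ-inj p , φ-inj q)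
mapPair-uEq⁻ φ-inj (inj₂ (p , q)) = inj₂ (φ-inj p , φ-inj q)

uEq? : (a b : Fin k × Fin k) → Dec (UEq a b)
uEq? (a , b) (c , d) = ((a ≟ c) ×-dec (b ≟ d)) ⊎-dec ((a ≟ d) ×-dec (b ≟ c))

Adjacent : (H : Gr) → Rel (V H) 0ℓ
Adjacent H x y = Σ[ e ∈ E H ] UEq (ends H e) (x , y)

adjacent-sym : ∀ {H} → Symmetric (Adjacent H)
adjacent-sym (e , inj₁ (p , q)) = e , inj₂ (p , q)
adjacent-sym (e , inj₂ (p , q)) = e , inj₁ (p , q)

edgewise-monochromatic : ∀ {H} {P : Pred (V H) 0ℓ} {c : V H → Bool} →
  (∀ e → P (proj₁ (ends H e)) → P (proj₂ (ends H e)) →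
    c (proj₁ (ends H e)) ≡ c (proj₂ (ends H e))) →
  Monochromatic (Adjacent H) P c
edgewise-monochromatic mono (e , inj₁ (refl , refl)) Px Py = mono e Px Py
edgewise-monochromatic mono (e , inj₂ (refl , refl)) Px Py = sym (mono e Py Px)

module _ (G : MGraph) where

  Link : Rel (Fin (n G)) 0ℓ
  Link = Adjacent (toGr G)

  link? : Decidable₂ Link
  link? x y = any? λ e → uEq? (endsG G e) (x , y)

  edge-link : ∀ e → Link (proj₁ (endsG G e)) (proj₂ (endsG G e))
  edge-link e = e , inj₁ (refl , refl)

link-sym : Symmetric (Link G)
link-sym {G} = adjacent-sym {toGr G}

module _ (G : MGraph) {P : Pred (Fin (n G)) 0ℓ} (P? : Decidable P) where

  linked⇒walks : Connected (Link G) P → ConnectedOn (toGr G) P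
  linked⇒walks = connected⇒walks (link-sym {G}) (link? G) P?

  linked⊎cut : Connected (Link G) P ⊎ Cut (Link G) P
  linked⊎cut = connected⊎cut (link-sym {G}) (link? G) P?

_∖_ : Pred (Fin k) 0ℓ → Fin k → Pred (Fin k) 0ℓ
(P ∖ v) x = P x × x ≢ v

_∖?_ : {P : Pred (Fin k) 0ℓ} → Decidable P → ∀ v → Decidable (P ∖ v)
(P? ∖? v) x = P? x ×-dec (x ≢? v)

record TwoConnectedOn (G : MGraph) (S : Subset (n G)) : Set where
  field
    two         : AtLeastTwo S
    connected   : Connected (Link G) (_∈ S)
    connected-∖ : ∀ v → Connected (Link G) ((_∈ S) ∖ v)

twoConnectedOn-cong : {S S′ : Subset (n G)} → S ≗ S′ → TwoConnectedOn G S → TwoConnectedOn G S′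
twoConnectedOn-cong {S = S} {S′} S≗S′ S-conn = record
  { two         = atLeastTwo-⊆ (λ _ → S⇒S′) two
  ; connected   = connected-resp-≐ (S⇒S′ , S′⇒S) connected
  ; connected-∖ = λ v → connected-resp-≐ (Product.map₁ S⇒S′ , Product.map₁ S′⇒S) (connected-∖ v) }
  where
  open TwoConnectedOn S-conn
  S⇒S′ : ∀ {x} → x ∈ S → x ∈ S′
  S⇒S′ {x} = trans (sym (S≗S′ x))
  S′⇒S : ∀ {x} → x ∈ S′ → x ∈ S
  S′⇒S {x} = trans (S≗S′ x)

TwoConnected : MGraph → Set
TwoConnected G = TwoConnectedOn G full

twoConn⇒twoConnected : TwoConn (toGr G) → TwoConnected G
twoConn⇒twoConnected (_ , (x , y , x≢y) , walks , walks-∖) = record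
  { two         = x , y , x≢y , refl , refl
  ; connected   = λ c mono _ _ →
      walk-monochromatic (λ x~y _ _ → mono x~y refl refl) (walks _ _ tt tt)
  ; connected-∖ = λ v c mono (_ , x≢v) (_ , y≢v) →
      walk-monochromatic (λ x~y x≢v y≢v → mono x~y (refl , x≢v) (refl , y≢v))
        (walks-∖ v _ _ x≢v y≢v) }

twoConnected⇒twoConn : LoopFree G → TwoConnected G → TwoConn (toGr G)
twoConnected⇒twoConn {G} loopFree G-conn = let x , y , x≢y , _ = two in
  loopFree , (x , y , x≢y)
  , linked⇒walks G (λ _ → yes tt) (connected-resp-≐ (_ , λ _ → refl) connected)
  , λ v → linked⇒walks G (_≢? v) (connected-resp-≐ (proj₂ , (refl ,_)) (connected-∖ v))
  where open TwoConnectedOn G-conn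

∃-T-≡ : {S : Subset k} {a b : ∃[ x ] T (S x)} → proj₁ a ≡ proj₁ b → a ≡ b
∃-T-≡ {a = x , p} {.x , q} refl = cong (x ,_) (T-irrelevant p q)

module _ {G : MGraph} {S : Subset (n G)} where

  induced-adjacent : ∀ {a b} → Adjacent (induced G S) a b → Link G (proj₁ a) (proj₁ b)
  induced-adjacent ((e , _) , inj₁ (refl , refl)) = e , inj₁ (refl , refl)
  induced-adjacent ((e , _) , inj₂ (refl , refl)) = e , inj₂ (refl , refl)

  adjacent-induced : ∀ {x y} → Link G x y → (p : T (S x)) (q : T (S y)) →
    Adjacent (induced G S) (x , p) (y , q)
  adjacent-induced (e , inj₁ (refl , refl)) p q = (e , p , q) , inj₁ (refl , refl)
  adjacent-induced (e , inj₂ (refl , refl)) p q = (e , q , p) , inj₂ (refl , refl)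

  module _ {P : Pred (Fin (n G)) 0ℓ} {Q : Pred (V (induced G S)) 0ℓ}
    (P⇒Q : ∀ {x} → P x → Σ[ p ∈ T (S x) ] Q (x , p)) (Q⇒P : ∀ {a} → Q a → P (proj₁ a)) where

    induced-walks⇒connected : ConnectedOn (induced G S) Q → Connected (Link G) P
    induced-walks⇒connected walks c mono Px Py = let p , Qx = P⇒Q Px ; q , Qy = P⇒Q Py in
      walk-monochromatic {c = c ∘ proj₁}
        (λ a~b Qa Qb → mono (induced-adjacent a~b) (Q⇒P Qa) (Q⇒P Qb)) (walks (_ , p) (_ , q) Qx Qy)

    connected⇒induced-walks : Decidable P → Connected (Link G) P → ConnectedOn (induced G S) Q
    connected⇒induced-walks P? connected (x , p) (y , q) Qx Qy =
      lift (linked⇒walks G P? connected x y (Q⇒P Qx) (Q⇒P Qy)) Qx Qy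
      where
      lift : ∀ {x y p q} → Walk (Link G) P x y → Q (x , p) → Q (y , q) →
        Walk (Adjacent (induced G S)) Q (x , p) (y , q)
      lift ε _ _ = reflexive _ (∃-T-≡ {S = S} refl)
      lift ((_ , Pz , x~z) ◅ walk) Qx Qy = let r , Qz = P⇒Q Pz in
        (Qx , Qz , adjacent-induced x~z _ r) ◅ lift walk Qz Qy

  induced-≢ : {a b : V (induced G S)} → a ≢ b → proj₁ a ≢ proj₁ b
  induced-≢ a≢b = a≢b ∘ ∃-T-≡ {S = S}

  induced⇒twoConnectedOn : TwoConn (induced G S) → TwoConnectedOn G S
  induced⇒twoConnectedOn (_ , ((x , p) , (y , q) , a≢b) , walks , walks-∖) = record
    { two = x , y , induced-≢ a≢b , T⇒∈ p , T⇒∈ q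
    ; connected = connected ; connected-∖ = λ v → connected-∖ v (∈⊎∉ S v) }
    where
    connected : Connected (Link G) (_∈ S)
    connected = induced-walks⇒connected (λ x∈S → ∈⇒T x∈S , tt) (λ {a} _ → T⇒∈ (proj₂ a)) walks
    connected-∖ : ∀ v → v ∈ S ⊎ v ∉ S → Connected (Link G) ((_∈ S) ∖ v)
    connected-∖ v (inj₁ v∈S) = induced-walks⇒connected
      (λ (x∈S , x≢v) → ∈⇒T x∈S , x≢v ∘ cong proj₁)
      (λ {a} a≢v → T⇒∈ (proj₂ a) , induced-≢ a≢v) (walks-∖ (v , ∈⇒T v∈S))
    connected-∖ v (inj₂ v∉S) =
      connected-resp-≐ ((λ x∈S → x∈S , ∈∉⇒≢ x∈S v∉S) , proj₁) connected

  twoConnectedOn⇒induced : LoopFree G → TwoConnectedOn G S → TwoConn (induced G S)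
  twoConnectedOn⇒induced loopFree S-conn = let x , y , x≢y , x∈S , y∈S = two in
    (λ (e , _) → loopFree e ∘ cong proj₁)
    , ((x , ∈⇒T x∈S) , (y , ∈⇒T y∈S) , x≢y ∘ cong proj₁)
    , connected⇒induced-walks (λ x∈S → ∈⇒T x∈S , tt) (λ {a} _ → T⇒∈ (proj₂ a)) (_∈? S) connected
    , λ (v , _) → connected⇒induced-walks
        (λ (x∈S , x≢v) → ∈⇒T x∈S , x≢v ∘ cong proj₁)
        (λ {a} a≢v → T⇒∈ (proj₂ a) , induced-≢ a≢v) ((_∈? S) ∖? v) (connected-∖ v)
    where open TwoConnectedOn S-conn

-- Contractions

-- The type of the second argument of the private helper behind `qmap` mentions `S x`, which blocks
-- a case split on `S x`; wrapping the hypothesis on that argument lets both be abstracted together.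
record HoldsOutside {X : Set} (R : X ⊎ ⊤ → Set) {b : Bool} (f : T (not b) → X) : Set where
  constructor holds-outside
  field at : ∀ p → R (inj₁ (f p))

module _ {G : MGraph} {S : Subset (n G)} where

  qmap-split : ∀ x (R : QV G S → Set) →
    HoldsOutside R {S x} (λ p → x , p) → (x ∈ S → R (inj₂ tt)) → R (qmap G S x)
  qmap-split x R with S x | (λ (p : T (not (S x))) → _,_ {B = λ x → T (not (S x))} x p)
  ... | true  | f = λ _ inside → inside refl
  ... | false | f = λ outside _ → HoldsOutside.at outside tt

  qmap-elim : ∀ x (R : QV G S → Set) →
    (∀ p → R (inj₁ (x , p))) → (x ∈ S → R (inj₂ tt)) → R (qmap G S x)
  qmap-elim x R outside = qmap-split x R (holds-outside outside)

  qmap-∈ : ∀ {x} → x ∈ S → qmap G S x ≡ inj₂ tt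
  qmap-∈ {x} x∈S = qmap-elim x (_≡ inj₂ tt) (λ p → contradiction (T⇒∉ p) (not-¬ x∈S)) (λ _ → refl)

  qmap-∉ : ∀ {x} (p : T (not (S x))) → qmap G S x ≡ inj₁ (x , p)
  qmap-∉ {x} p = qmap-elim x (_≡ inj₁ (x , p))
    (λ q → cong (inj₁ ∘ (x ,_)) (T-irrelevant q p)) (λ x∈S → contradiction (T⇒∉ p) (not-¬ x∈S))

  qmap≢tt⇒∉ : ∀ {x} → qmap G S x ≢ inj₂ tt → x ∉ S
  qmap≢tt⇒∉ qx≢tt = ¬-not (qx≢tt ∘ qmap-∈)

  ∉⇒qmap≢tt : ∀ {x} → x ∉ S → qmap G S x ≢ inj₂ tt
  ∉⇒qmap≢tt x∉S qx≡tt with () ← trans (sym (qmap-∉ (∉⇒T x∉S))) qx≡tt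

  qmap-injective-∉ : ∀ {x y} → x ∉ S → qmap G S x ≡ qmap G S y → x ≡ y
  qmap-injective-∉ {x} {y} x∉S qx≡qy = cong proj₁ (inj₁-injective
    (trans (sym (qmap-∉ {x} (∉⇒T x∉S))) (trans qx≡qy (qmap-∉ {y} (∉⇒T y∉S)))))
    where
    y∉S : y ∉ S
    y∉S = qmap≢tt⇒∉ (∉⇒qmap≢tt x∉S ∘ trans qx≡qy)

  contractSet⇒connected : TwoConn (contractSet G S) → Connected (Link G) (_∉ S)
  contractSet⇒connected (_ , _ , _ , walks-∖) c mono {x} {y} x∉S y∉S = begin
    c x                  ≡⟨ colour-qmap x∉S ⟨
    colour (qmap G S x)  ≡⟨ walk-monochromatic colour-mono
      (walks-∖ (inj₂ tt) _ _ (∉⇒qmap≢tt x∉S) (∉⇒qmap≢tt y∉S)) ⟩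
    colour (qmap G S y)  ≡⟨ colour-qmap y∉S ⟩
    c y                  ∎
    where
    open ≡-Reasoning
    colour : QV G S → Bool
    colour (inj₁ (x , _)) = c x
    colour (inj₂ _)       = true
    colour-qmap : ∀ {x} → x ∉ S → colour (qmap G S x) ≡ c x
    colour-qmap x∉S = cong colour (qmap-∉ (∉⇒T x∉S))
    colour-end : ∀ {x} → qmap G S x ≢ inj₂ tt → colour (qmap G S x) ≡ c x
    colour-end = colour-qmap ∘ qmap≢tt⇒∉
    colour-mono : Monochromatic (Adjacent (contractSet G S)) (_≢ inj₂ tt) colour
    colour-mono = edgewise-monochromatic λ (e , _) a≢ b≢ → trans (colour-end a≢)
      (trans (mono (edge-link G e) (qmap≢tt⇒∉ a≢) (qmap≢tt⇒∉ b≢)) (sym (colour-end b≢)))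

  module _ {keep : Fin (m G) → Bool} (keep≗ : keep ≗ not ∘ inE G S) where

    private
      Q : Gr
      Q = quot G S keep

    qmap-adjacent : ∀ {x y} → Link G x y →
      qmap G S x ≡ qmap G S y ⊎ Adjacent Q (qmap G S x) (qmap G S y)
    qmap-adjacent (e , ue) with ∈⊎∉ keep e
    ... | inj₁ kept = inj₂ ((e , ∈⇒T kept) , mapPair-uEq⁺ (qmap G S) ue)
    ... | inj₂ dropped = inj₁ (trans (qmap-∈ x∈S) (sym (qmap-∈ y∈S)))
      where
      xy⊆S : _ ∈ S × _ ∈ S
      xy⊆S = ∧-true⁻ _ _ (trans (sym (uEq-∧ S ue)) (not-injective (trans (sym (keep≗ e)) dropped)))
      x∈S : _ ∈ S
      x∈S = proj₁ xy⊆S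
      y∈S : _ ∈ S
      y∈S = proj₂ xy⊆S

    connected⇒quot-walks : (∃[ z ] z ∈ S) → {R : Pred (QV G S) 0ℓ} → Decidable (R ∘ qmap G S) →
      Connected (Link G) (R ∘ qmap G S) → ConnectedOn Q R
    connected⇒quot-walks (z , z∈S) {R} R? connected a b Ra Rb with surjective a | surjective b
      where
      surjective : ∀ a → ∃[ x ] qmap G S x ≡ a
      surjective (inj₁ (x , p)) = x , qmap-∉ p
      surjective (inj₂ tt)      = z , qmap-∈ z∈S
    ... | x , refl | y , refl =
      kleisliStar (qmap G S) push (linked⇒walks G R? connected x y Ra Rb)
      where
      push : ∀ {x y} → R (qmap G S x) × R (qmap G S y) × Link G x y →
        Walk (Adjacent Q) R (qmap G S x) (qmap G S y)
      push (Rx , Ry , x~y) =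
        [ reflexive _ , (λ qx~qy → return (Rx , Ry , qx~qy)) ] (qmap-adjacent x~y)

    quot-twoConn : LoopFree G → TwoConnected G → (∃[ z ] z ∈ S) → (∃[ x ] x ∉ S) →
      Connected (Link G) (_∉ S) → TwoConn Q
    quot-twoConn loopFree G-conn inhabited (x , x∉S) outside = noLoop
      , (qmap G S x , inj₂ tt , ∉⇒qmap≢tt x∉S)
      , connected⇒quot-walks inhabited (λ _ → yes tt)
          (connected-resp-≐ (_ , λ _ → refl) connected)
      , walks-∖
      where
      open TwoConnectedOn G-conn using (connected; connected-∖)
      noLoop : ∀ e → proj₁ (ends Q e) ≢ proj₂ (ends Q e)
      noLoop (e , kept) loop with ∈⊎∉ S (proj₁ (endsG G e)) | ∈⊎∉ S (proj₂ (endsG G e))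
      ... | inj₂ a∉S | _        = loopFree e (qmap-injective-∉ a∉S loop)
      ... | inj₁ _   | inj₂ b∉S = loopFree e (sym (qmap-injective-∉ b∉S (sym loop)))
      ... | inj₁ a∈S | inj₁ b∈S = not-¬ (trans (sym (keep≗ e)) (T⇒∈ kept))
                                        (cong not (cong₂ _∧_ a∈S b∈S))
      walks-∖ : ∀ a → ConnectedOn Q (_≢ a)
      walks-∖ (inj₂ tt) = connected⇒quot-walks inhabited dec
        (connected-resp-≐ (∉⇒qmap≢tt , qmap≢tt⇒∉) outside)
        where
        dec : Decidable (λ x → qmap G S x ≢ inj₂ tt)
        dec x = map′ ∉⇒qmap≢tt qmap≢tt⇒∉ (x ∉? S)
      walks-∖ (inj₁ (v , p)) = connected⇒quot-walks inhabited (λ x → map′ to from (x ≢? v))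
        (connected-resp-≐ ((λ (_ , x≢v) → to x≢v) , (λ qx≢ → refl , from qx≢)) (connected-∖ v))
        where
        to : ∀ {x} → x ≢ v → qmap G S x ≢ inj₁ (v , p)
        to x≢v qx≡ = x≢v (sym (qmap-injective-∉ (T⇒∉ p) (trans (qmap-∉ p) (sym qx≡))))
        from : ∀ {x} → qmap G S x ≢ inj₁ (v , p) → x ≢ v
        from qx≢ refl = qx≢ (qmap-∉ p)

-- Good flats

record Good (G : MGraph) (S : Subset (n G)) : Set where
  field
    proper  : Proper S
    inside  : TwoConnectedOn G S
    outside : Connected (Link G) (_∉ S)

good-cong : {S S′ : Subset (n G)} → S ≗ S′ → Good G S → Good G S′
good-cong S≗S′ good = record
  { proper  = map₂ (trans (sym (S≗S′ _))) proper
  ; inside  = twoConnectedOn-cong S≗S′ inside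
  ; outside = connected-resp-≐ (trans (sym (S≗S′ _)) , trans (S≗S′ _)) outside }
  where open Good good

goodFlat⇒good : ∀ {S} → GoodFlat G S → Good G S
goodFlat⇒good (proper , inside , outside) = record
  { proper  = proper
  ; inside  = induced⇒twoConnectedOn inside
  ; outside = contractSet⇒connected outside }

good⇒goodFlat : LoopFree G → TwoConnected G → ∀ {S} → Good G S → GoodFlat G S
good⇒goodFlat loopFree G-conn good = let x , _ , _ , x∈S , _ = two in
  proper
  , twoConnectedOn⇒induced loopFree inside
  , quot-twoConn (λ _ → refl) loopFree G-conn (x , x∈S) proper outside
  where
  open Good good
  open TwoConnectedOn inside

-- Deletion and contraction of an edge

inE-pair⁺ : ∀ G {u v} e → UEq (endsG G e) (u , v) → e ∈ inE G (pair u v)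
inE-pair⁺ G {u} {v} e ue =
  trans (uEq-∧ (pair u v) ue) (cong₂ _∧_ (x∈pair-xy u v) (y∈pair-xy u v))

inE-pair⁻ : LoopFree G → ∀ {u v e} → e ∈ inE G (pair u v) → UEq (endsG G e) (u , v)
inE-pair⁻ loopFree {e = e} e∈ with ∧-true⁻ _ _ e∈
... | a∈ , b∈ with z∈pair-xy⇒z≡x⊎z≡y a∈ | z∈pair-xy⇒z≡x⊎z≡y b∈
... | inj₁ a≡u | inj₂ b≡v = inj₁ (a≡u , b≡v)
... | inj₂ a≡v | inj₁ b≡u = inj₂ (a≡v , b≡u)
... | inj₁ a≡u | inj₁ b≡u = contradiction (trans a≡u (sym b≡u)) (loopFree e)
... | inj₂ a≡v | inj₂ b≡v = contradiction (trans a≡v (sym b≡v)) (loopFree e)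

module Deletion {G : MGraph} (loopFree : LoopFree G) (G-conn : TwoConnected G) (f : Fin (m G)) where

  open TwoConnectedOn G-conn using (connected; connected-∖)

  u v : Fin (n G)
  u = proj₁ (endsG G f)
  v = proj₂ (endsG G f)

  Link⁻ : Rel (Fin (n G)) 0ℓ
  Link⁻ = Adjacent (delete G f)

  link⁻? : Decidable₂ Link⁻
  link⁻? x y = map′ (λ (e , e≢f , ue) → (e , ∉⇒T (x≢y⇒x∉⁅y⁆ e≢f)) , ue)
    (λ ((e , kept) , ue) → e , x∉⁅y⁆⇒x≢y (T⇒∉ kept) , ue)
    (any? λ e → (e ≢? f) ×-dec uEq? (endsG G e) (x , y))

  link⇒link⁻ : ∀ {x y} → Link G x y → UEq (u , v) (x , y) ⊎ Link⁻ x y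
  link⇒link⁻ (e , ue) with e ≟ f
  ... | yes refl = inj₁ ue
  ... | no e≢f   = inj₂ ((e , ∉⇒T (x≢y⇒x∉⁅y⁆ e≢f)) , ue)

  EndsAgree : Pred (Fin (n G)) 0ℓ → Set
  EndsAgree P = P u → P v → ∀ d → Monochromatic Link⁻ P d → d u ≡ d v

  delete-connected : ∀ {P} → EndsAgree P → Connected (Link G) P → Connected Link⁻ P
  delete-connected {P} agree P-conn d mono⁻ = P-conn d mono
    where
    mono : Monochromatic (Link G) P d
    mono x~y Px Py with link⇒link⁻ x~y
    ... | inj₁ (inj₁ (refl , refl)) = agree Px Py d mono⁻
    ... | inj₁ (inj₂ (refl , refl)) = sym (agree Py Px d mono⁻)
    ... | inj₂ x~⁻y                 = mono⁻ x~⁻y Px Py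

  delete-twoConn : EndsAgree (_∈ full) → (∀ w → EndsAgree (_≢ w)) → TwoConn (delete G f)
  delete-twoConn agree agree-∖ = (λ (e , _) → loopFree e) , (u , v , loopFree f)
    , connected⇒walks (adjacent-sym {delete G f}) link⁻? (λ _ → yes tt)
        (connected-resp-≐ (_ , λ _ → refl) (delete-connected agree connected))
    , λ w → connected⇒walks (adjacent-sym {delete G f}) link⁻? (_≢? w)
        (delete-connected (agree-∖ w) (connected-resp-≐ (proj₂ , (refl ,_)) (connected-∖ w)))

  parallel⇒delete : Link⁻ u v → TwoConn (delete G f)
  parallel⇒delete u~⁻v = delete-twoConn (λ _ _ d mono → mono u~⁻v refl refl)
    (λ w u≢w v≢w d mono → mono u~⁻v u≢w v≢w)

  -- The colour class of x, together with u and v, contains a walk from u to v.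
  cut⇒endsAgree : (cut : Cut (Link G) (_∉ pair u v)) → ∀ {P} →
    (∀ {z} → z ∉ pair u v → z ∈ Cut.colour cut → P z) → EndsAgree P
  cut⇒endsAgree cut {P} K⊆P Pu Pv d mono⁻ = trans
    (sym (attached u v (loopFree f) (λ _ → z∈pair-xy⇒z≡x⊎z≡y) u∈ v∈ Pu))
    (attached v u (loopFree f ∘ sym) (λ _ → swap ∘ z∈pair-xy⇒z≡x⊎z≡y) v∈ u∈ Pv)
    where
    open Cut cut

    u∈ : u ∈ pair u v
    u∈ = x∈pair-xy u v

    v∈ : v ∈ pair u v
    v∈ = y∈pair-xy u v

    K : Subset (n G)
    K z = not (pair u v z) ∧ colour z

    K⁺ : ∀ {z} → z ∉ pair u v → z ∈ colour → z ∈ K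
    K⁺ z∉ z∈ = cong₂ (λ a b → not a ∧ b) z∉ z∈

    K⁻ : ∀ {z} → z ∈ K → z ∉ pair u v × z ∈ colour
    K⁻ {z} z∈K = let z∉ , z∈ = ∧-true⁻ _ _ z∈K in not-injective z∉ , z∈

    pair∉K : ∀ {z} → z ∈ pair u v → z ∉ K
    pair∉K z∈ = cong (λ b → not b ∧ colour _) z∈

    d-link : ∀ {y z} → y ∈ K → Link G y z → P z → d y ≡ d z
    d-link y∈K y~z Pz with link⇒link⁻ y~z | K⁻ y∈K
    ... | inj₂ y~⁻z                 | y∉ , y∈ = mono⁻ y~⁻z (K⊆P y∉ y∈) Pz
    ... | inj₁ (inj₁ (refl , refl)) | y∉ , _  = contradiction y∉ (not-¬ u∈)
    ... | inj₁ (inj₂ (refl , refl)) | y∉ , _  = contradiction y∉ (not-¬ v∈)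

    attached : ∀ a b → a ≢ b → (∀ z → z ∈ pair u v → z ≡ a ⊎ z ≡ b) →
      a ∈ pair u v → b ∈ pair u v → P a → d x ≡ d a
    attached a b a≢b a⊎b a∈ b∈ Pa = begin
      d x                   ≡⟨ recolour-∈ K d (d a) x∈K ⟨
      recolour K d (d a) x  ≡⟨ connected-∖ b (recolour K d (d a))
                                 (recolour-monochromatic K d (d a) (link-sym {G}) within leaving)
                                 (refl , ∈∉⇒≢ b∈ Px ∘ sym) (refl , a≢b) ⟩
      recolour K d (d a) a  ≡⟨ recolour-∉ K d (d a) (pair∉K a∈) ⟩
      d a                   ∎
      where
      open ≡-Reasoning
      x∈K : x ∈ K
      x∈K = K⁺ Px x∈colour
      within : Monochromatic (Link G) (λ z → ((_∈ full) ∖ b) z × z ∈ K) d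
      within y~z (_ , y∈K) (_ , z∈K) = let z∉ , z∈ = K⁻ z∈K in d-link y∈K y~z (K⊆P z∉ z∈)
      leaving : ∀ {y z} → Link G y z → ((_∈ full) ∖ b) y → ((_∈ full) ∖ b) z →
        y ∈ K → z ∉ K → d y ≡ d a
      leaving {z = z} y~z _ (_ , z≢b) y∈K z∉K with ∈⊎∉ (pair u v) z | K⁻ y∈K
      ... | inj₂ z∉ | y∉ , y∈ =
        contradiction z∉K (not-¬ (K⁺ z∉ (trans (sym (monochromatic y~z y∉ z∉)) y∈)))
      ... | inj₁ z∈ | _ with a⊎b z z∈
      ... | inj₁ refl = d-link y∈K y~z Pa
      ... | inj₂ z≡b  = contradiction z≡b z≢b

  cut⇒delete : Cut (Link G) (_∉ pair u v) → TwoConn (delete G f)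
  cut⇒delete cut = delete-twoConn (cut⇒endsAgree cut λ _ _ → refl) avoiding
    where
    avoiding : ∀ w → EndsAgree (_≢ w)
    avoiding w with ∈⊎∉ (Cut.colour cut) w
    ... | inj₂ w∉ = cut⇒endsAgree cut λ _ z∈ → ∈∉⇒≢ z∈ w∉
    ... | inj₁ w∈ = cut⇒endsAgree (flip-cut cut) λ _ z∈ → ∈∉⇒≢ z∈ (cong not w∈)

  -- The graphic case of Tutte's theorem on deletion and contraction in connected matroids.
  delete⊎contract : 2 ≤ m G → TwoConn (delete G f) ⊎ TwoConn (contractEdge G f)
  delete⊎contract 2≤m with link⁻? u v
  ... | yes u~⁻v = inj₁ (parallel⇒delete u~⁻v)
  ... | no simple = decide (any? (_∉? pair u v))
    where
    only-f : ∀ {e} → e ∈ inE G (pair u v) → e ≡ f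
    only-f {e} e∈ with e ≟ f
    ... | yes e≡f = e≡f
    ... | no e≢f  =
      contradiction ((e , ∉⇒T (x≢y⇒x∉⁅y⁆ e≢f)) , inE-pair⁻ loopFree {e = e} e∈) simple
    ⁅f⁆≗inE-pair : ⁅ f ⁆ ≗ inE G (pair u v)
    ⁅f⁆≗inE-pair e = ⇔→≡ (mk⇔
      (⁅x⁆⊆ (inE G (pair u v)) (inE-pair⁺ G f (inj₁ (refl , refl))) e)
      (λ e∈ → subst (_∈ ⁅ f ⁆) (sym (only-f e∈)) (x∈⁅x⁆ f)))
    decide : Dec (∃[ x ] x ∉ pair u v) → TwoConn (delete G f) ⊎ TwoConn (contractEdge G f)
    decide (no none) = let e , e≢f = another 2≤m f ; a , b = endsG G e in
      contradiction (only-f (cong₂ _∧_ (in-pair a) (in-pair b))) e≢f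
      where
      in-pair : ∀ x → x ∈ pair u v
      in-pair x = ¬-not λ x∉ → none (x , x∉)
    decide (yes proper) with linked⊎cut G (_∉? pair u v)
    ... | inj₂ cut     = inj₁ (cut⇒delete cut)
    ... | inj₁ outside = inj₂ (quot-twoConn (cong not ∘ ⁅f⁆≗inE-pair) loopFree G-conn
      (u , x∈pair-xy u v) proper outside)

-- (♠)₂ without weights

edges : (G : MGraph) → Subset (n G) → ℕ
edges G S = size (inE G S)

Tight Sparse : ℕ → (G : MGraph) → Subset (n G) → Set
Tight  j G S = edges G S + j ≡ 2 * size S
Sparse j G S = edges G S + j ≤ 2 * size S

record Balanced (G : MGraph) : Set where
  field
    total : Tight 2 G full
    flat  : ∀ {S} → Good G S → Tight 3 G S

edges-cong : ∀ G {S S′ : Subset (n G)} → S ≗ S′ → edges G S ≡ edges G S′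
edges-cong G {S′ = S′} S≗S′ = size-cong {S′ = inE G S′} λ e → cong₂ _∧_ (S≗S′ _) (S≗S′ _)

tight-cong : ∀ G j {S S′ : Subset (n G)} → S ≗ S′ → Tight j G S → Tight j G S′
tight-cong G j S≗S′ = subst₂ (λ e s → e + j ≡ 2 * s) (edges-cong G S≗S′) (size-cong S≗S′)

full-tight⇔ : ∀ G → Tight 2 G full ⇔ m G + 2 ≡ 2 * n G
full-tight⇔ G rewrite size-full {m G} | size-full {n G} = mk⇔ id id

twoConnectedOn⇒2≤size : ∀ {S} → TwoConnectedOn G S → 2 ≤ size S
twoConnectedOn⇒2≤size {S = S} S-conn = atLeastTwo⇒2≤size S (TwoConnectedOn.two S-conn)

twoConnected⇒2≤n : TwoConnected G → 2 ≤ n G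
twoConnected⇒2≤n {G} G-conn = subst (2 ≤_) size-full (twoConnectedOn⇒2≤size G-conn)

tight⇒2≤m : TwoConnected G → Tight 2 G full → 2 ≤ m G
tight⇒2≤m {G} G-conn total = +-cancelʳ-≤ 2 2 (m G) (subst (4 ≤_)
  (sym (Equivalence.to (full-tight⇔ G) total)) (*-monoʳ-≤ 2 (twoConnected⇒2≤n G-conn)))

≡2*pred⇔+2≡2* : ∀ {a b} → 2 ≤ b → a ≡ 2 * (b ∸ 1) ⇔ a + 2 ≡ 2 * b
≡2*pred⇔+2≡2* {a} {suc b} _ = mk⇔
  (λ a≡ → trans (cong (_+ 2) a≡) (sym (2*-suc b)))
  (λ a+2≡ → +-cancelʳ-≡ 2 a (2 * b) (trans a+2≡ (2*-suc b)))
  where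
  2*-suc : ∀ b → 2 * suc b ≡ 2 * b + 2
  2*-suc = solve-∀

weight≡1 : ∀ {w} → IsWeight 2 G w → ∀ e → w e ≡ 1
weight≡1 isWeight e with isWeight e
... | deleted , _ , inj₁ del         = deleted del
... | _ , contracted , inj₂ contract = contracted contract

spade⇔balanced : LoopFree G → TwoConnected G → Spade 2 G ⇔ Balanced G
spade⇔balanced {G} loopFree G-conn = mk⇔ spade⇒balanced balanced⇒spade
  where
  total⇔ : m G ≡ 2 * (n G ∸ 1) ⇔ m G + 2 ≡ 2 * n G
  total⇔ = ≡2*pred⇔+2≡2* (twoConnected⇒2≤n G-conn)

  flat⇔ : ∀ {S} → Good G S → edges G S + 1 ≡ 2 * (size S ∸ 1) ⇔ Tight 3 G S
  flat⇔ {S} good = subst (λ a → edges G S + 1 ≡ 2 * (size S ∸ 1) ⇔ a ≡ 2 * size S)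
    (+-assoc (edges G S) 1 2) (≡2*pred⇔+2≡2* (twoConnectedOn⇒2≤size (Good.inside good)))

  spade⇒balanced : Spade 2 G → Balanced G
  spade⇒balanced (w , isWeight , total , flat) = record
    { total = Equivalence.from (full-tight⇔ G)
        (Equivalence.to total⇔ (trans (sym total-weight) total))
    ; flat  = λ {S} good → Equivalence.to (flat⇔ good)
        (trans (cong (_+ 1) (weight-inside S)) (flat S (good⇒goodFlat loopFree G-conn good))) }
    where
    total-weight : sumF w ≡ m G
    total-weight = trans (sumF-cong (weight≡1 isWeight)) size-full
    weight-inside : ∀ S → edges G S ≡ wE G w S
    weight-inside S = sumF-cong λ e → cong (if inE G S e then_else 0) (sym (weight≡1 isWeight e))

  balanced⇒spade : Balanced G → Spade 2 G
  balanced⇒spade balanced = (λ _ → 1)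
    , (λ e → (λ _ → refl) , (λ _ → refl)
        , Deletion.delete⊎contract loopFree G-conn e (tight⇒2≤m G-conn total))
    , trans size-full (Equivalence.from total⇔ (Equivalence.to (full-tight⇔ G) total))
    , λ S goodFlat → let good = goodFlat⇒good goodFlat in Equivalence.from (flat⇔ good) (flat good)
    where open Balanced balanced

-- Separations

inE-∩ : ∀ G (S S′ : Subset (n G)) → inE G (S ∩ S′) ≗ inE G S ∩ inE G S′
inE-∩ G S T e = ∧-interchange (S a) (T a) (S b) (T b)
  where
  a b : Fin (n G)
  a = proj₁ (endsG G e)
  b = proj₂ (endsG G e)

inE-mono : ∀ G {S S′ : Subset (n G)} → S ⊆ S′ → inE G S ⊆ inE G S′
inE-mono G S⊆S′ e e∈S = let a∈S , b∈S = ∧-true⁻ _ _ e∈S in cong₂ _∧_ (S⊆S′ _ a∈S) (S⊆S′ _ b∈S)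

record Separation (G : MGraph) (Q C : Subset (n G)) : Set where
  field
    L R         : Subset (n G)
    L∪R≗Q       : L ∪ R ≗ Q
    L∩R≗C       : L ∩ R ≗ C
    no-crossing : ∀ {x y} → Link G x y → x ∈ Q → y ∈ Q → x ∈ L × y ∈ L ⊎ x ∈ R × y ∈ R
    {x y}       : Fin (n G)
    x∈L         : x ∈ L
    x∉R         : x ∉ R
    y∈R         : y ∈ R
    y∉L         : y ∉ L

  flip : Separation G Q C
  flip = record
    { L = R ; R = L
    ; L∪R≗Q = λ z → trans (∨-comm (R z) (L z)) (L∪R≗Q z)
    ; L∩R≗C = λ z → trans (∧-comm (R z) (L z)) (L∩R≗C z)
    ; no-crossing = λ x~y x∈Q y∈Q → swap (no-crossing x~y x∈Q y∈Q)
    ; x∈L = y∈R ; x∉R = y∉L ; y∈R = x∈L ; y∉L = x∉R }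

  L⊆Q : L ⊆ Q
  L⊆Q z z∈L = trans (sym (L∪R≗Q z)) (S⊆S∪S′ L R z z∈L)

  R⊆Q : R ⊆ Q
  R⊆Q z z∈R = trans (sym (L∪R≗Q z)) (S′⊆S∪S′ L R z z∈R)

  C⊆L : C ⊆ L
  C⊆L z z∈C = proj₁ (∧-true⁻ _ _ (trans (L∩R≗C z) z∈C))

  x∉C : x ∉ C
  x∉C = trans (sym (L∩R≗C x)) (trans (cong (L x ∧_) x∉R) (∧-zeroʳ (L x)))

  L<Q : size L < size Q
  L<Q = size-mono-< L Q L⊆Q y∉L (R⊆Q y y∈R)

  inE-L∪R : inE G L ∪ inE G R ≗ inE G Q
  inE-L∪R e = ⇔→≡ (mk⇔ ([ inE-mono G L⊆Q e , inE-mono G R⊆Q e ] ∘ ∨-true⁻ _ _) split)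
    where
    split : e ∈ inE G Q → e ∈ inE G L ∪ inE G R
    split e∈Q = let a∈Q , b∈Q = ∧-true⁻ _ _ e∈Q in
      [ (λ (a∈L , b∈L) → S⊆S∪S′ (inE G L) (inE G R) e (cong₂ _∧_ a∈L b∈L))
      , (λ (a∈R , b∈R) → S′⊆S∪S′ (inE G L) (inE G R) e (cong₂ _∧_ a∈R b∈R))
      ]′ (no-crossing (edge-link G e) a∈Q b∈Q)

  inE-L∩R : inE G L ∩ inE G R ≗ inE G C
  inE-L∩R e = trans (sym (inE-∩ G L R e)) (cong₂ _∧_ (L∩R≗C _) (L∩R≗C _))

  vertex-counts : size Q + size C ≡ size L + size R
  vertex-counts = trans (sym (cong₂ _+_ (size-cong L∪R≗Q) (size-cong L∩R≗C))) (size-∪-∩ L R)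

  edge-counts : edges G Q + edges G C ≡ edges G L + edges G R
  edge-counts = trans (sym (cong₂ _+_ (size-cong inE-L∪R) (size-cong inE-L∩R)))
    (size-∪-∩ (inE G L) (inE G R))

  sides-sparse : ∀ {a b} → Sparse a G L → Sparse b G R →
    edges G Q + edges G C + (a + b) ≤ 2 * size Q + 2 * size C
  sides-sparse {a} {b} L-sparse R-sparse = begin
    edges G Q + edges G C + (a + b)    ≡⟨ cong (_+ (a + b)) edge-counts ⟩
    edges G L + edges G R + (a + b)    ≡⟨ +-interchange (edges G L) (edges G R) a b ⟩
    (edges G L + a) + (edges G R + b)  ≤⟨ +-mono-≤ L-sparse R-sparse ⟩
    2 * size L + 2 * size R            ≡⟨ *-distribˡ-+ 2 (size L) (size R) ⟨
    2 * (size L + size R)              ≡⟨ cong (2 *_) vertex-counts ⟨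
    2 * (size Q + size C)              ≡⟨ *-distribˡ-+ 2 (size Q) (size C) ⟩
    2 * size Q + 2 * size C            ∎
    where open ≤-Reasoning

  union-sparse : ∀ {a b} j c → Sparse a G L → Sparse b G R → a + b ≡ j + c →
    2 * size C ≤ edges G C + c → Sparse j G Q
  union-sparse j c L-sparse R-sparse a+b≡j+c C-dense = +-cancelʳ-≤ (edges G C + c) _ _ (begin
    edges G Q + j + (edges G C + c)  ≡⟨ +-interchange (edges G Q) j (edges G C) c ⟩
    edges G Q + edges G C + (j + c)  ≡⟨ cong (edges G Q + edges G C +_) a+b≡j+c ⟨
    edges G Q + edges G C + _        ≤⟨ sides-sparse L-sparse R-sparse ⟩
    2 * size Q + 2 * size C          ≤⟨ +-monoʳ-≤ (2 * size Q) C-dense ⟩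
    2 * size Q + (edges G C + c)     ∎)
    where open ≤-Reasoning

  overlap-sparse : ∀ {a b} j c → Sparse a G L → Sparse b G R → a + b ≡ j + c →
    2 * size Q ≤ edges G Q + c → Sparse j G C
  overlap-sparse j c L-sparse R-sparse a+b≡j+c Q-dense = +-cancelˡ-≤ (edges G Q + c) _ _ (begin
    edges G Q + c + (edges G C + j)  ≡⟨ +-interchange (edges G Q) c (edges G C) j ⟩
    edges G Q + edges G C + (c + j)  ≡⟨ cong (edges G Q + edges G C +_) (+-comm c j) ⟩
    edges G Q + edges G C + (j + c)  ≡⟨ cong (edges G Q + edges G C +_) a+b≡j+c ⟨
    edges G Q + edges G C + _        ≤⟨ sides-sparse L-sparse R-sparse ⟩
    2 * size Q + 2 * size C          ≤⟨ +-monoˡ-≤ (2 * size C) Q-dense ⟩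
    edges G Q + c + 2 * size C       ∎)
    where open ≤-Reasoning

cut⇒separation : ∀ {Q C} → C ⊆ Q → Cut (Link G) (λ x → x ∈ Q × x ∉ C) → Separation G Q C
cut⇒separation {G} {Q} {C} C⊆Q cut = record
  { L = side true ; R = side false ; L∪R≗Q = union ; L∩R≗C = inter ; no-crossing = no-crossing
  ; x∈L = side⁺ true (proj₁ Px) (inj₂ x∈colour) ; x∉R = side⁻ false (proj₂ Px) (not-¬ x∈colour)
  ; y∈R = side⁺ false (proj₁ Py) (inj₂ y∉colour) ; y∉L = side⁻ true (proj₂ Py) (not-¬ y∉colour) }
  where
  open Cut cut

  side : Bool → Subset (n G)
  side b z = Q z ∧ (C z ∨ does (colour z 𝔹.≟ b))

  side⁺ : ∀ b {z} → z ∈ Q → z ∈ C ⊎ colour z ≡ b → z ∈ side b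
  side⁺ b {z} z∈Q (inj₁ z∈C) = cong₂ _∧_ z∈Q (cong (_∨ _) z∈C)
  side⁺ b {z} z∈Q (inj₂ z≡b) =
    cong₂ _∧_ z∈Q (trans (cong (C z ∨_) (dec-true (colour z 𝔹.≟ b) z≡b)) (∨-zeroʳ (C z)))

  side⁻ : ∀ b {z} → z ∉ C → colour z ≢ b → z ∉ side b
  side⁻ b {z} z∉C z≢b =
    trans (cong (Q z ∧_) (cong₂ _∨_ z∉C (dec-false (colour z 𝔹.≟ b) z≢b))) (∧-zeroʳ (Q z))

  union : side true ∪ side false ≗ Q
  union z with Q z | C z | colour z
  ... | false | _     | _     = refl
  ... | true  | true  | _     = refl
  ... | true  | false | true  = refl
  ... | true  | false | false = refl

  inter : side true ∩ side false ≗ C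
  inter z with Q z | C z | colour z | C⊆Q z
  ... | true  | true  | _     | _   = refl
  ... | true  | false | true  | _   = refl
  ... | true  | false | false | _   = refl
  ... | false | false | _     | _   = refl
  ... | false | true  | _     | C⊆Q with () ← C⊆Q refl

  no-crossing : ∀ {a b} → Link G a b → a ∈ Q → b ∈ Q →
    a ∈ side true × b ∈ side true ⊎ a ∈ side false × b ∈ side false
  no-crossing {a} {b} a~b a∈Q b∈Q with common-side (∈⊎∉ C a) (∈⊎∉ C b)
    where
    common-side : a ∈ C ⊎ a ∉ C → b ∈ C ⊎ b ∉ C → ∃[ k ] (a ∈ side k × b ∈ side k)
    common-side (inj₁ a∈C) _ =
      colour b , side⁺ _ a∈Q (inj₁ a∈C) , side⁺ _ b∈Q (inj₂ refl)
    common-side (inj₂ a∉C) (inj₁ b∈C) =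
      colour a , side⁺ _ a∈Q (inj₂ refl) , side⁺ _ b∈Q (inj₁ b∈C)
    common-side (inj₂ a∉C) (inj₂ b∉C) =
      colour a , side⁺ _ a∈Q (inj₂ refl)
               , side⁺ _ b∈Q (inj₂ (sym (monochromatic a~b (a∈Q , a∉C) (b∈Q , b∉C))))
  ... | true  , a∈b∈ = inj₁ a∈b∈
  ... | false , a∈b∈ = inj₂ a∈b∈

module _ {Q C : Subset (n G)} (sep : Separation G Q C) where

  open Separation sep

  -- A colouring of L extends to Q ∖ L by its constant value on C.
  side-connected : {P : Pred (Fin (n G)) 0ℓ} → (∃[ z ] (z ∈ C × P z)) →
    Connected (Link G) (λ z → z ∈ C × P z) → Connected (Link G) (λ z → z ∈ Q × P z) →
    Connected (Link G) (λ z → z ∈ L × P z)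
  side-connected {P} (s , s∈C , Ps) C-conn Q-conn d mono {a} {b} (a∈L , Pa) (b∈L , Pb) = begin
    d a                   ≡⟨ recolour-∈ L d (d s) a∈L ⟨
    recolour L d (d s) a  ≡⟨ Q-conn (recolour L d (d s))
                               (recolour-monochromatic L d (d s) (link-sym {G}) within leaving)
                               (L⊆Q _ a∈L , Pa) (L⊆Q _ b∈L , Pb) ⟩
    recolour L d (d s) b  ≡⟨ recolour-∈ L d (d s) b∈L ⟩
    d b                   ∎
    where
    open ≡-Reasoning
    within : Monochromatic (Link G) (λ z → (z ∈ Q × P z) × z ∈ L) d
    within x~y ((_ , Px) , x∈L) ((_ , Py) , y∈L) = mono x~y (x∈L , Px) (y∈L , Py)
    C-mono : Monochromatic (Link G) (λ z → z ∈ C × P z) d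
    C-mono x~y (x∈C , Px) (y∈C , Py) = mono x~y (C⊆L _ x∈C , Px) (C⊆L _ y∈C , Py)
    leaving : ∀ {x y} → Link G x y → x ∈ Q × P x → y ∈ Q × P y → x ∈ L → y ∉ L → d x ≡ d s
    leaving x~y (x∈Q , Px) (y∈Q , _) x∈L y∉L with no-crossing x~y x∈Q y∈Q
    ... | inj₁ (_ , y∈L) = contradiction y∉L (not-¬ y∈L)
    ... | inj₂ (x∈R , _) = C-conn d C-mono (x∈C , Px) (s∈C , Ps)
      where
      x∈C : _ ∈ C
      x∈C = trans (sym (L∩R≗C _)) (cong₂ _∧_ x∈L x∈R)

  side-twoConnected : TwoConnectedOn G C → TwoConnectedOn G Q → TwoConnectedOn G L
  side-twoConnected C-conn Q-conn = record
    { two         = atLeastTwo-⊆ C⊆L C.two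
    ; connected   = connected-resp-≐ (proj₁ , (_, tt)) (side-connected (map₂ (_, tt) nonempty)
        (connected-resp-≐ ((_, tt) , proj₁) C.connected)
        (connected-resp-≐ ((_, tt) , proj₁) Q.connected))
    ; connected-∖ = λ v → side-connected (avoiding v C.two) (C.connected-∖ v) (Q.connected-∖ v) }
    where
    module C = TwoConnectedOn C-conn
    module Q = TwoConnectedOn Q-conn
    nonempty : ∃ (_∈ C)
    nonempty = let x , _ , _ , x∈C , _ = C.two in x , x∈C
    avoiding : ∀ v → AtLeastTwo C → ∃[ z ] (z ∈ C × z ≢ v)
    avoiding v (x , y , x≢y , x∈C , y∈C) with x ≟ v
    ... | yes refl = y , y∈C , x≢y ∘ sym
    ... | no x≢v   = x , x∈C , x≢v

-- Sparsity

sparse-weaken : ∀ {i j S} → i ≤ j → Sparse j G S → Sparse i G S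
sparse-weaken {G} {S = S} i≤j = ≤-trans (+-monoʳ-≤ (edges G S) i≤j)

subsingleton⇒∉inE : LoopFree G → ∀ {S} → (∀ {x y} → x ∈ S → y ∈ S → x ≡ y) → ∀ e → e ∉ inE G S
subsingleton⇒∉inE loopFree unique e = ¬-not λ e∈S →
  let a∈S , b∈S = ∧-true⁻ _ _ e∈S in loopFree e (unique a∈S b∈S)

edges-subsingleton : LoopFree G → ∀ {S} → (∀ {x y} → x ∈ S → y ∈ S → x ≡ y) → edges G S ≡ 0
edges-subsingleton loopFree unique = size-empty (subsingleton⇒∉inE loopFree unique)

module Sparsity {G : MGraph} (loopFree : LoopFree G) (G-conn : TwoConnected G)
  (balanced : Balanced G) where

  open Balanced balanced

  good⊎sparse⇒sparse : ∀ {S} → Good G S ⊎ Sparse 4 G S → Sparse 3 G S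
  good⊎sparse⇒sparse (inj₁ good)       = ≤-reflexive (flat good)
  good⊎sparse⇒sparse {S} (inj₂ sparse) = sparse-weaken {G} {S = S} (n≤1+n 3) sparse

  twoConnectedOn⇒good⊎sparse : ∀ S → Acc _<_ (size (∁ S)) → TwoConnectedOn G S → Proper S →
    Good G S ⊎ Sparse 4 G S
  twoConnectedOn⇒good⊎sparse S (acc rec) S-conn proper with linked⊎cut G (_∉? S)
  ... | inj₁ outside = inj₁ record { proper = proper ; inside = S-conn ; outside = outside }
  ... | inj₂ cut     = inj₂ (Separation.overlap-sparse sep 4 2
    (side-sparse sep) (side-sparse (Separation.flip sep)) refl (≤-reflexive (sym total)))
    where
    sep : Separation G full S
    sep = cut⇒separation (λ _ _ → refl) (cut-resp-≐ ((refl ,_) , proj₂) cut)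
    side-sparse : (sep : Separation G full S) → Sparse 3 G (Separation.L sep)
    side-sparse sep = good⊎sparse⇒sparse (twoConnectedOn⇒good⊎sparse L
      (rec (size-∁-anti-< S L C⊆L x∉C x∈L)) (side-twoConnected sep S-conn G-conn) (y , y∉L))
      where open Separation sep

  SparseBelow : ℕ → Set
  SparseBelow s = ∀ S → size S < s → Proper S → AtLeastTwo S → Sparse 3 G S

  nonempty⇒sparse : ∀ {S} → SparseBelow (suc (size S)) → Proper S → ∃ (_∈ S) → Sparse 2 G S
  nonempty⇒sparse {S} below proper (x , x∈S) with any? (λ y → (x ≢? y) ×-dec (y ∈? S))
  ... | yes (y , x≢y , y∈S) =
    sparse-weaken {G} {S = S} (n≤1+n 2) (below S ≤-refl proper (x , y , x≢y , x∈S , y∈S))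
  ... | no only-x = begin
    edges G S + 2  ≡⟨ cong (_+ 2) (edges-subsingleton loopFree
                        λ y∈S z∈S → trans (sym (≡x y∈S)) (≡x z∈S)) ⟩
    2              ≤⟨ *-monoʳ-≤ 2 (nonempty⇒1≤size S (x , x∈S)) ⟩
    2 * size S     ∎
    where
    open ≤-Reasoning
    ≡x : ∀ {y} → y ∈ S → x ≡ y
    ≡x {y} y∈S = decidable-stable (x ≟ y) λ x≢y → only-x (y , x≢y , y∈S)

  disconnected⇒sparse : ∀ {S} → SparseBelow (size S) → Proper S → Separation G S ∅ → Sparse 4 G S
  disconnected⇒sparse {S} below proper sep = Separation.union-sparse sep 4 0
    (side-sparse sep) (side-sparse (Separation.flip sep)) refl
    (subst (_≤ edges G ∅ + 0) (sym (cong (2 *_) (size-empty {n G} λ _ → refl))) z≤n)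
    where
    side-sparse : (sep : Separation G S ∅) → Sparse 2 G (Separation.L sep)
    side-sparse sep =
      nonempty⇒sparse (λ S′ S≤L → below S′ (<-≤-trans S≤L L<Q)) (proper-⊆ L⊆Q proper) (x , x∈L)
      where open Separation sep

  cutVertex⇒sparse : ∀ {S} v → SparseBelow (size S) → Proper S → Separation G S ⁅ v ⁆ → Sparse 4 G S
  cutVertex⇒sparse {S} v below proper sep = Separation.union-sparse sep 4 2
    (side-sparse sep) (side-sparse (Separation.flip sep)) refl
    (subst (_≤ edges G ⁅ v ⁆ + 2) (sym (cong (2 *_) (size-⁅⁆ v))) (m≤n+m 2 (edges G ⁅ v ⁆)))
    where
    side-sparse : (sep : Separation G S ⁅ v ⁆) → Sparse 3 G (Separation.L sep)
    side-sparse sep = below L L<Q (proper-⊆ L⊆Q proper)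
      (x , v , x∉⁅y⁆⇒x≢y x∉C , x∈L , C⊆L v (x∈⁅x⁆ v))
      where open Separation sep

  good⊎sparse : ∀ S → Acc _<_ (size S) → Proper S → AtLeastTwo S → Good G S ⊎ Sparse 4 G S
  good⊎sparse S (acc rec) proper two =
    by-connectedness (linked⊎cut G (_∈? S)) (any⊎all λ v → swap (linked⊎cut G ((_∈? S) ∖? v)))
    where
    below : SparseBelow (size S)
    below S′ S′<S proper two = good⊎sparse⇒sparse (good⊎sparse S′ (rec S′<S) proper two)

    by-connectedness : Connected (Link G) (_∈ S) ⊎ Cut (Link G) (_∈ S) →
      (∃[ v ] Cut (Link G) ((_∈ S) ∖ v)) ⊎ (∀ v → Connected (Link G) ((_∈ S) ∖ v)) →
      Good G S ⊎ Sparse 4 G S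
    by-connectedness (inj₂ cut) _ = inj₂ (disconnected⇒sparse below proper
      (cut⇒separation (λ _ ()) (cut-resp-≐ ((_, refl) , proj₁) cut)))
    by-connectedness (inj₁ connected) (inj₂ connected-∖) =
      twoConnectedOn⇒good⊎sparse S (<-wellFounded _)
        record { two = two ; connected = connected ; connected-∖ = connected-∖ } proper
    by-connectedness (inj₁ connected) (inj₁ (v , cut)) with ∈⊎∉ S v
    ... | inj₁ v∈S = inj₂ (cutVertex⇒sparse v below proper (cut⇒separation (⁅x⁆⊆ S v∈S)
      (cut-resp-≐ (map₂ x≢y⇒x∉⁅y⁆ , map₂ x∉⁅y⁆⇒x≢y) cut)))
    ... | inj₂ v∉S = contradiction
      (connected-resp-≐ ((λ z∈S → z∈S , ∈∉⇒≢ z∈S v∉S) , proj₁) connected) (cut⇒¬connected cut)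

  module _ {u v : Fin (n G)} (u≢v : u ≢ v) where

    private
      side-good⊎sparse : (sep : Separation G full (pair u v)) → let open Separation sep in
        Good G L ⊎ Sparse 4 G L
      side-good⊎sparse sep = good⊎sparse L (<-wellFounded _) (y , y∉L)
        (u , v , u≢v , C⊆L u (x∈pair-xy u v) , C⊆L v (y∈pair-xy u v))
        where open Separation sep

      pair-edges-≤ : (sep : Separation G full (pair u v)) → let open Separation sep in
        ∀ {a b} j → Sparse a G L → Sparse b G R → a + b ≡ j + 2 → edges G (pair u v) + j ≤ 4
      pair-edges-≤ sep j L-sparse R-sparse a+b≡j+2 =
        subst (edges G (pair u v) + j ≤_) (cong (2 *_) (size-pair u≢v))
          (Separation.overlap-sparse sep j 2 L-sparse R-sparse a+b≡j+2 (≤-reflexive (sym total)))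

    side-good : (sep : Separation G full (pair u v)) → Good G (Separation.L sep)
    side-good sep with side-good⊎sparse sep
    ... | inj₁ good   = good
    ... | inj₂ sparse = contradiction (m+n≤o⇒n≤o (edges G (pair u v)) (pair-edges-≤ sep 5 sparse
      (good⊎sparse⇒sparse (side-good⊎sparse (Separation.flip sep))) refl)) (n≮n 4)

    twoCut-nonadjacent : Separation G full (pair u v) → edges G (pair u v) ≡ 0
    twoCut-nonadjacent sep = n≤0⇒n≡0 (+-cancelʳ-≤ 4 _ _ (pair-edges-≤ sep 4
      (≤-reflexive (flat (side-good sep)))
      (≤-reflexive (flat (side-good (Separation.flip sep)))) refl))

-- The 2-cycle

good⇒2≤size : ∀ {S} → Good G S → 2 ≤ size S
good⇒2≤size good = twoConnectedOn⇒2≤size (Good.inside good)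

good⇒size<n : ∀ {S} → Good G S → size S < n G
good⇒size<n {G} {S} good = let x , x∉S = Good.proper good in
  subst (size S <_) size-full (size-mono-< S full (λ _ _ → refl) x∉S refl)

C₂⇒balanced : IsC2 G → Balanced G
C₂⇒balanced {G} (n≡2 , m≡2 , _) = record
  { total = Equivalence.from (full-tight⇔ G) (trans (cong (_+ 2) m≡2) (cong (2 *_) (sym n≡2)))
  ; flat  = λ {S} good → contradiction (good⇒2≤size good)
      (<⇒≱ (subst (size S <_) n≡2 (good⇒size<n good))) }

balanced⇒C₂ : LoopFree G → Balanced G → n G ≡ 2 → IsC2 G
balanced⇒C₂ {G} loopFree balanced n≡2 = n≡2 , m≡2 , loopFree
  where
  m≡2 : m G ≡ 2
  m≡2 = +-cancelʳ-≡ 2 (m G) 2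
    (trans (Equivalence.to (full-tight⇔ G) (Balanced.total balanced)) (cong (2 *_) n≡2))

-- The complete graph on four vertices

pairs : Fin 6 → Fin 4 × Fin 4
pairs 0F = 0F , 1F
pairs 1F = 0F , 2F
pairs 2F = 0F , 3F
pairs 3F = 1F , 2F
pairs 4F = 1F , 3F
pairs 5F = 2F , 3F

pairs-distinct : ∀ j → proj₁ (pairs j) ≢ proj₂ (pairs j)
pairs-distinct = from-yes (all? λ j → proj₁ (pairs j) ≢? proj₂ (pairs j))

pairs-injective : ∀ i j → UEq (pairs i) (pairs j) → i ≡ j
pairs-injective = from-yes (all? λ i → all? λ j → uEq? (pairs i) (pairs j) →-dec (i ≟ j))

pairs-surjective : ∀ u v → u ≢ v → ∃[ j ] UEq (pairs j) (u , v)
pairs-surjective = from-yes (all? λ u → all? λ v → (u ≢? v) →-dec any? λ j → uEq? (pairs j) (u , v))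

size-pairs : (S : Subset 4) → 2 ≤ size S → size S < 4 →
  size (λ j → S (proj₁ (pairs j)) ∧ S (proj₂ (pairs j))) + 3 ≡ 2 * size S
size-pairs S 2≤ <4 with S 0F | S 1F | S 2F | S 3F
... | true  | true  | true  | false = refl
... | true  | true  | false | true  = refl
... | true  | true  | false | false = refl
... | true  | false | true  | true  = refl
... | true  | false | true  | false = refl
... | true  | false | false | true  = refl
... | false | true  | true  | true  = refl
... | false | true  | true  | false = refl
... | false | true  | false | true  = refl
... | false | false | true  | true  = refl
size-pairs S _ (s≤s (s≤s (s≤s (s≤s ())))) | true | true | true | true
size-pairs S (s≤s ()) _ | true  | false | false | false
size-pairs S (s≤s ()) _ | false | true  | false | false
size-pairs S (s≤s ()) _ | false | false | true  | false
size-pairs S (s≤s ()) _ | false | false | false | true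
size-pairs S () _       | false | false | false | false

K₄⇒balanced : IsK4 G → Balanced G
K₄⇒balanced {G@record { n = .4 ; m = m }} (refl , loopFree , unique) = record
  { total = trans (cong (_+ 2) (edges-pairs full)) refl
  ; flat  = λ {S} good → trans (cong (_+ 3) (edges-pairs S))
      (size-pairs S (good⇒2≤size good) (good⇒size<n good)) }
  where
  edge : Fin 6 → Fin m
  edge j = proj₁ (unique _ _ (pairs-distinct j))
  edge-ends : ∀ j → UEq (endsG G (edge j)) (pairs j)
  edge-ends j = proj₁ (proj₂ (unique _ _ (pairs-distinct j)))
  edge-injective : Injective _≡_ _≡_ edge
  edge-injective {i} {j} eq = pairs-injective i j (uEq-trans (uEq-sym (edge-ends i))
    (subst (λ e → UEq (endsG G e) (pairs j)) (sym eq) (edge-ends j)))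
  edge-surjective : ∀ e → e ∈ image edge
  edge-surjective e with pairs-surjective _ _ (loopFree e)
  ... | j , ue = subst (_∈ image edge)
    (sym (proj₂ (proj₂ (unique _ _ (pairs-distinct j))) e (uEq-sym ue))) (∈-image⁺ edge j)
  edges-pairs : ∀ S → edges G S ≡ size (λ j → S (proj₁ (pairs j)) ∧ S (proj₂ (pairs j)))
  edges-pairs S = trans (sym (size-∘-bijective edge-injective edge-surjective (inE G S)))
    (size-cong λ j → uEq-∧ S (edge-ends j))

incidences : (G : MGraph) → Fin (m G) → Fin (n G) → ℕ
incidences G e v = 𝟙 (⁅ proj₁ (endsG G e) ⁆ v) + 𝟙 (⁅ proj₂ (endsG G e) ⁆ v)

degree : (G : MGraph) → Fin (n G) → ℕ
degree G v = sumF λ e → incidences G e v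

handshake : ∀ G → sumF (degree G) ≡ m G * 2
handshake G = begin
  sumF (degree G)                     ≡⟨ sumF-comm (λ v e → incidences G e v) ⟩
  sumF (λ e → sumF (incidences G e))  ≡⟨ sumF-cong two-ends ⟩
  sumF {m G} (λ _ → 2)                ≡⟨ sumF-const (m G) 2 ⟩
  m G * 2                             ∎
  where
  open ≡-Reasoning
  two-ends : ∀ e → sumF (incidences G e) ≡ 2
  two-ends e = let a , b = endsG G e in
    trans (sumF-distrib-+ (𝟙 ∘ ⁅ a ⁆) (𝟙 ∘ ⁅ b ⁆)) (cong₂ _+_ (size-⁅⁆ a) (size-⁅⁆ b))

edges-∁⁅⁆ : LoopFree G → ∀ v → edges G (∁ ⁅ v ⁆) + degree G v ≡ m G
edges-∁⁅⁆ {G} loopFree v = begin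
  edges G (∁ ⁅ v ⁆) + degree G v
    ≡⟨ sumF-distrib-+ (𝟙 ∘ inE G (∁ ⁅ v ⁆)) (λ e → incidences G e v) ⟨
  sumF (λ e → 𝟙 (inE G (∁ ⁅ v ⁆) e) + incidences G e v)
    ≡⟨ sumF-cong (λ e → avoids-or-ends-at (loopFree e)) ⟩
  size (full {m G})
    ≡⟨ size-full ⟩
  m G ∎
  where
  open ≡-Reasoning
  avoids-or-ends-at : ∀ {a b} → a ≢ b →
    𝟙 (∁ ⁅ v ⁆ a ∧ ∁ ⁅ v ⁆ b) + (𝟙 (⁅ a ⁆ v) + 𝟙 (⁅ b ⁆ v)) ≡ 1
  avoids-or-ends-at {a} {b} a≢b
    rewrite does-⇔ (mk⇔ sym sym) (v ≟ a) (a ≟ v) | does-⇔ (mk⇔ sym sym) (v ≟ b) (b ≟ v)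
    with a ≟ v | b ≟ v
  ... | yes a≡v | yes b≡v = contradiction (trans a≡v (sym b≡v)) a≢b
  ... | yes _   | no _    = refl
  ... | no _    | yes _   = refl
  ... | no _    | no _    = refl

complementary-pair : k ≡ 4 → (u v : Fin k) → u ≢ v →
  ∃[ w ] ∃[ z ] (w ≢ z × (∀ x → ∁ (pair w z) x ≡ pair u v x))
complementary-pair refl = from-yes (all? {4} λ u → all? λ v → (u ≢? v) →-dec
  any? λ w → any? λ z → (w ≢? z) ×-dec all? λ x → ∁ (pair w z) x 𝔹.≟ pair u v x)

link⇒pair-twoConnected : ∀ {u v} → u ≢ v → Link G u v → TwoConnectedOn G (pair u v)
link⇒pair-twoConnected {G} {u} {v} u≢v u~v = record
  { two = u , v , u≢v , x∈pair-xy u v , y∈pair-xy u v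
  ; connected = within id ; connected-∖ = λ _ → within proj₁ }
  where
  within : {P : Pred (Fin (n G)) 0ℓ} → (∀ {x} → P x → x ∈ pair u v) → Connected (Link G) P
  within P⊆pair c mono {x} {y} Px Py
    with z∈pair-xy⇒z≡x⊎z≡y {x = u} {v} {x} (P⊆pair Px)
       | z∈pair-xy⇒z≡x⊎z≡y {x = u} {v} {y} (P⊆pair Py)
  ... | inj₁ refl | inj₁ refl = refl
  ... | inj₂ refl | inj₂ refl = refl
  ... | inj₁ refl | inj₂ refl = mono u~v Px Py
  ... | inj₂ refl | inj₁ refl = mono (link-sym {G} u~v) Px Py

pair-connected⇒link : LoopFree G → ∀ {u v} → u ≢ v → Connected (Link G) (_∈ pair u v) → Link G u v
pair-connected⇒link {G} loopFree {u} {v} u≢v connected with link? G u v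
... | yes u~v = u~v
... | no u≁v  = contradiction
  (trans (sym (connected ⁅ u ⁆ mono {u} {v} (x∈pair-xy u v) (y∈pair-xy u v))) (x∈⁅x⁆ u))
  (not-¬ (x≢y⇒x∉⁅y⁆ (u≢v ∘ sym)))
  where
  mono : Monochromatic (Link G) (_∈ pair u v) ⁅ u ⁆
  mono (e , ue) x∈ y∈ = contradiction
    (e , inE-pair⁻ loopFree {e = e} (trans (uEq-∧ (pair u v) ue) (cong₂ _∧_ x∈ y∈))) u≁v

module ThreeConnected {G : MGraph} (loopFree : LoopFree G) (G-conn : TwoConnected G)
  (balanced : Balanced G) (3≤n : 3 ≤ n G)
  (connected-∖∖ : ∀ u v → u ≢ v → Connected (Link G) (_∉ pair u v)) where

  open TwoConnectedOn G-conn using (connected-∖)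
  open Balanced balanced

  ∁⁅⁆-good : ∀ v → Good G (∁ ⁅ v ⁆)
  ∁⁅⁆-good v = record { proper = v , cong not (x∈⁅x⁆ v) ; inside = inside ; outside = outside }
    where
    ≢⇒∈∁ : ∀ {x} → x ≢ v → x ∈ ∁ ⁅ v ⁆
    ≢⇒∈∁ = cong not ∘ x≢y⇒x∉⁅y⁆
    ∈∁⇒≢ : ∀ {x} → x ∈ ∁ ⁅ v ⁆ → x ≢ v
    ∈∁⇒≢ = x∉⁅y⁆⇒x≢y ∘ not-injective
    ∁-connected : Connected (Link G) (_∈ ∁ ⁅ v ⁆)
    ∁-connected = connected-resp-≐ (≢⇒∈∁ ∘ proj₂ , (λ x∈ → refl , ∈∁⇒≢ x∈)) (connected-∖ v)
    ∁-connected-∖ : ∀ w → Connected (Link G) ((_∈ ∁ ⁅ v ⁆) ∖ w)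
    ∁-connected-∖ w with v ≟ w
    ... | yes refl = connected-resp-≐ ((λ x∈ → x∈ , ∈∁⇒≢ x∈) , proj₁) ∁-connected
    ... | no v≢w   = connected-resp-≐
      ( (λ x∉ → let x≢v , x≢w = z∉pair-xy⇒z≢x×z≢y x∉ in ≢⇒∈∁ x≢v , x≢w)
      , (λ (x∈ , x≢w) → z≢x⇒z≢y⇒z∉pair-xy (∈∁⇒≢ x∈) x≢w)) (connected-∖∖ v w v≢w)
    inside : TwoConnectedOn G (∁ ⁅ v ⁆)
    inside = let x , y , x≢y , x≢v , y≢v = two-others 3≤n v in record
      { two = x , y , x≢y , ≢⇒∈∁ x≢v , ≢⇒∈∁ y≢v
      ; connected = ∁-connected ; connected-∖ = ∁-connected-∖ }
    outside : Connected (Link G) (_∉ ∁ ⁅ v ⁆)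
    outside = connected-subsingleton λ x∉ y∉ →
      trans (x∈⁅y⁆⇒x≡y {y = v} (not-injective x∉)) (sym (x∈⁅y⁆⇒x≡y (not-injective y∉)))

  degree≡3 : ∀ v → degree G v ≡ 3
  degree≡3 v = +-cancelʳ-≡ 2 _ _ (+-cancelˡ-≡ (edges G (∁ ⁅ v ⁆)) _ _ (begin
    edges G (∁ ⁅ v ⁆) + (degree G v + 2)  ≡⟨ +-assoc (edges G (∁ ⁅ v ⁆)) (degree G v) 2 ⟨
    edges G (∁ ⁅ v ⁆) + degree G v + 2    ≡⟨ cong (_+ 2) (edges-∁⁅⁆ loopFree v) ⟩
    m G + 2                               ≡⟨ Equivalence.to (full-tight⇔ G) total ⟩
    2 * n G                               ≡⟨ cong (2 *_) (size-∁⁅⁆ v) ⟨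
    2 * (size (∁ ⁅ v ⁆) + 1)              ≡⟨ *-distribˡ-+ 2 (size (∁ ⁅ v ⁆)) 1 ⟩
    2 * size (∁ ⁅ v ⁆) + 2                ≡⟨ cong (_+ 2) (flat (∁⁅⁆-good v)) ⟨
    edges G (∁ ⁅ v ⁆) + 3 + 2             ≡⟨ +-assoc (edges G (∁ ⁅ v ⁆)) 3 2 ⟩
    edges G (∁ ⁅ v ⁆) + (3 + 2)           ∎))
    where open ≡-Reasoning

  n≡4 : n G ≡ 4
  n≡4 = +-cancelˡ-≡ (n G * 3) (n G) 4 (begin
    n G * 3 + n G        ≡⟨ 3n+n (n G) ⟩
    2 * (2 * n G)        ≡⟨ cong (2 *_) (Equivalence.to (full-tight⇔ G) total) ⟨
    2 * (m G + 2)        ≡⟨ 2m+4 (m G) ⟩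
    m G * 2 + 4          ≡⟨ cong (_+ 4) (handshake G) ⟨
    sumF (degree G) + 4  ≡⟨ cong (_+ 4) (trans (sumF-cong degree≡3) (sumF-const (n G) 3)) ⟩
    n G * 3 + 4          ∎)
    where
    open ≡-Reasoning
    3n+n : ∀ n → n * 3 + n ≡ 2 * (2 * n)
    3n+n = solve-∀
    2m+4 : ∀ m → 2 * (m + 2) ≡ m * 2 + 4
    2m+4 = solve-∀

  linked : ∀ {u v} → u ≢ v → Link G u v
  linked {u} {v} u≢v = let w , z , w≢z , ∁wz≗uv = complementary-pair n≡4 u v u≢v in
    pair-connected⇒link loopFree u≢v (connected-resp-≐
      ( (λ {x} x∉wz → trans (sym (∁wz≗uv x)) (cong not x∉wz))
      , (λ {x} x∈uv → not-injective (trans (∁wz≗uv x) x∈uv))) (connected-∖∖ w z w≢z))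

  edges-pair≡1 : ∀ {u v} → u ≢ v → edges G (pair u v) ≡ 1
  edges-pair≡1 {u} {v} u≢v =
    +-cancelʳ-≡ 3 _ _ (trans (flat pair-good) (cong (2 *_) (size-pair u≢v)))
    where
    pair-good : Good G (pair u v)
    pair-good = let w , z , _ , ∁wz≗uv = complementary-pair n≡4 u v u≢v in record
      { proper  = w , trans (sym (∁wz≗uv w)) (cong not (x∈pair-xy w z))
      ; inside  = link⇒pair-twoConnected u≢v (linked u≢v)
      ; outside = connected-∖∖ u v u≢v }

  isK₄ : IsK4 G
  isK₄ = n≡4 , loopFree , λ u v u≢v →
    let e , ue = linked u≢v in e , ue , λ f uf → unique u≢v ue uf
    where
    unique : ∀ {u v e f} → u ≢ v → UEq (endsG G e) (u , v) → UEq (endsG G f) (u , v) → f ≡ e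
    unique {u} {v} {e} {f} u≢v ue uf with f ≟ e
    ... | yes f≡e = f≡e
    ... | no f≢e  = contradiction
      (atLeastTwo⇒2≤size (inE G (pair u v)) (f , e , f≢e , inE-pair⁺ G f uf , inE-pair⁺ G e ue))
      (<⇒≱ (s≤s (≤-reflexive (edges-pair≡1 u≢v))))

-- Construction A

Other : Fin k → Set
Other {k} e = Σ[ f ∈ Fin k ] T (not (does (f ≟ e)))

other↔ : (e : Fin (suc k)) → Fin k ↔ Other e
other↔ {k} e = mk↔ₛ′ to from (λ f → other-≡ (punchIn-punchOut (≢e f)))
  (λ i → trans (punchOut-cong e refl) (punchOut-punchIn e))
  where
  to : Fin k → Other e
  to i = punchIn e i , ∉⇒T (x≢y⇒x∉⁅y⁆ (punchInᵢ≢i e i))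
  ≢e : (f : Other e) → e ≢ proj₁ f
  ≢e (f , kept) = x∉⁅y⁆⇒x≢y (T⇒∉ kept) ∘ sym
  from : Other e → Fin k
  from f = punchOut (≢e f)
  other-≡ : {f g : Other e} → proj₁ f ≡ proj₁ g → f ≡ g
  other-≡ {f , p} {.f , q} refl = cong (f ,_) (T-irrelevant p q)

size-⊎-↔ : (ψ : (Fin k ⊎ Fin l) ↔ Fin r) (S : Subset r) →
  size S ≡ size (S ∘ Inverse.to ψ ∘ inj₁) + size (S ∘ Inverse.to ψ ∘ inj₂)
size-⊎-↔ {k} {l} {r} ψ S = begin
  size S                                 ≡⟨ +-identityʳ (size S) ⟨
  size S + 0                             ≡⟨ cong (size S +_) (size-empty disjoint) ⟨
  size S + size (S ∩ image φ ∩ image χ)  ≡⟨ size-cover (inj₁-injective ∘ injective)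
                                              (inj₂-injective ∘ injective) cover S ⟩
  size (S ∘ φ) + size (S ∘ χ)            ∎
  where
  open ≡-Reasoning
  open Inverse ψ using (to; from; strictlyInverseˡ)
  open Injection (↔⇒↣ ψ) using (injective)
  φ : Fin k → Fin r
  φ = to ∘ inj₁
  χ : Fin l → Fin r
  χ = to ∘ inj₂
  images-disjoint : ∀ {z} → ∃[ x ] φ x ≡ z → ∃[ y ] χ y ≡ z → ⊥
  images-disjoint (x , φx≡z) (y , χy≡z) with () ← injective (trans φx≡z (sym χy≡z))
  disjoint : ∀ z → z ∉ S ∩ image φ ∩ image χ
  disjoint z = ¬-not λ z∈ →
    let z∈φ , z∈χ = ∧-true⁻ (image φ z) _ (∧-conicalʳ (S z) _ z∈)
    in images-disjoint (∈-image⁻ {φ = φ} {z} z∈φ) (∈-image⁻ {φ = χ} {z} z∈χ)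
  cover : ∀ z → z ∈ image φ ∪ image χ
  cover z = subst (_∈ image φ ∪ image χ) (strictlyInverseˡ z) (covered (from z))
    where
    covered : ∀ a → to a ∈ image φ ∪ image χ
    covered (inj₁ x) = S⊆S∪S′ (image φ) (image χ) (φ x) (∈-image⁺ φ x)
    covered (inj₂ y) = S′⊆S∪S′ (image φ) (image χ) (χ y) (∈-image⁺ χ y)

size-other-⊎-↔ : (e : Fin k) (e′ : Fin l) (ψ : (Other e ⊎ Other e′) ↔ Fin r) →
  (S : Subset r) (S₁ : Subset k) (S₂ : Subset l) →
  (∀ f → S (Inverse.to ψ (inj₁ f)) ≡ S₁ (proj₁ f)) →
  (∀ f → S (Inverse.to ψ (inj₂ f)) ≡ S₂ (proj₁ f)) →
  (𝟙 (S₁ e) + 𝟙 (S₂ e′)) + size S ≡ size S₁ + size S₂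
size-other-⊎-↔ {suc _} {suc _} e e′ ψ S S₁ S₂ S≗S₁ S≗S₂ = begin
  (𝟙 (S₁ e) + 𝟙 (S₂ e′)) + size S
    ≡⟨ cong ((𝟙 (S₁ e) + 𝟙 (S₂ e′)) +_) others ⟩
  (𝟙 (S₁ e) + 𝟙 (S₂ e′)) + (size (S₁ ∘ punchIn e) + size (S₂ ∘ punchIn e′))
    ≡⟨ +-interchange (𝟙 (S₁ e)) (𝟙 (S₂ e′)) (size (S₁ ∘ punchIn e)) (size (S₂ ∘ punchIn e′)) ⟩
  (𝟙 (S₁ e) + size (S₁ ∘ punchIn e)) + (𝟙 (S₂ e′) + size (S₂ ∘ punchIn e′))
    ≡⟨ cong₂ _+_ (size-punchIn S₁ e) (size-punchIn S₂ e′) ⟨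
  size S₁ + size S₂ ∎
  where
  open ≡-Reasoning
  others : size S ≡ size (S₁ ∘ punchIn e) + size (S₂ ∘ punchIn e′)
  others = trans (size-⊎-↔ (ψ ↔-∘ (other↔ e ⊎-↔ other↔ e′)) S) (cong₂ _+_
    (size-cong {S′ = S₁ ∘ punchIn e} (S≗S₁ ∘ Inverse.to (other↔ e)))
    (size-cong {S′ = S₂ ∘ punchIn e′} (S≗S₂ ∘ Inverse.to (other↔ e′))))

constrA-swap : ConstrA 2 G₁ G₂ H → ConstrA 2 G₂ G₁ H
constrA-swap {G₁} {G₂} C = record
  { tc₁ = tc₂ ; tc₂ = tc₁ ; e₁ = e₂ ; e₂ = e₁ ; w₁ = w₂ ; w₂ = w₁
  ; φ₁ = φ₂ ; φ₂ = φ₁ ; φ₁-inj = φ₂-inj ; φ₂-inj = φ₁-inj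
  ; cover = swap ∘ cover ; glue = uEq-sym glue ; only-glue = only-glue′
  ; ψ = ψ ↔-∘ mk↔ₛ′ swap swap swap-involutive swap-involutive
  ; ψ-ends₁ = ψ-ends₂ ; ψ-ends₂ = ψ-ends₁ }
  where
  open ConstrA C
  only-glue′ : ∀ y x → φ₂ y ≡ φ₁ x → y ≡ proj₁ (endsG G₂ e₂) ⊎ y ≡ proj₂ (endsG G₂ e₂)
  only-glue′ y x φ₂y≡φ₁x = Sum.map (φ₂-inj _ _) (φ₂-inj _ _) (uEq-∈ glue
    (Sum.map (trans φ₂y≡φ₁x ∘ cong φ₁) (trans φ₂y≡φ₁x ∘ cong φ₁) (only-glue x y (sym φ₂y≡φ₁x))))

module Gluing {G₁ G₂ H : MGraph} (C : ConstrA 2 G₁ G₂ H) where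

  open ConstrA C

  φ₁-injective : Injective _≡_ _≡_ φ₁
  φ₁-injective = φ₁-inj _ _

  loopFree₁ : LoopFree G₁
  loopFree₁ = proj₁ tc₁

  loopFree₂ : LoopFree G₂
  loopFree₂ = proj₁ tc₂

  L R : Subset (n H)
  L = image φ₁
  R = image φ₂

  L∪R-universal : ∀ z → z ∈ L ∪ R
  L∪R-universal z with cover z
  ... | inj₁ (x , refl) = S⊆S∪S′ L R z (∈-image⁺ φ₁ x)
  ... | inj₂ (y , refl) = S′⊆S∪S′ L R z (∈-image⁺ φ₂ y)

  ∈L⊎∈R : ∀ z → z ∈ L ⊎ z ∈ R
  ∈L⊎∈R z = ∨-true⁻ _ _ (L∪R-universal z)

  u₁ v₁ : Fin (n G₁)
  u₁ = proj₁ (endsG G₁ e₁)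
  v₁ = proj₂ (endsG G₁ e₁)

  u v : Fin (n H)
  u = φ₁ u₁
  v = φ₁ v₁

  u≢v : u ≢ v
  u≢v = loopFree₁ e₁ ∘ φ₁-injective

  Hinge : Pred (Fin (n H)) 0ℓ
  Hinge z = z ∈ L × z ∈ R

  uv∈R : u ∈ R × v ∈ R
  uv∈R = ∧-true⁻ _ _ (trans (uEq-∧ R glue) (cong₂ _∧_ (∈-image⁺ φ₂ _) (∈-image⁺ φ₂ _)))

  hinge-u : Hinge u
  hinge-u = ∈-image⁺ φ₁ u₁ , proj₁ uv∈R

  hinge-v : Hinge v
  hinge-v = ∈-image⁺ φ₁ v₁ , proj₂ uv∈R

  hinge⇒u⊎v : ∀ {z} → Hinge z → z ≡ u ⊎ z ≡ v
  hinge⇒u⊎v {z} (z∈L , z∈R) with ∈-image⁻ {φ = φ₁} {z} z∈L | ∈-image⁻ {φ = φ₂} {z} z∈R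
  ... | x , refl | y , φ₂y≡z = Sum.map (cong φ₁) (cong φ₁) (only-glue x y (sym φ₂y≡z))

  other-hinge : ∀ {h} → Hinge h → ∃[ g ] (Hinge g × (∀ {z} → Hinge z → z ≡ h ⊎ z ≡ g))
  other-hinge h-hinge with hinge⇒u⊎v h-hinge
  ... | inj₁ refl = v , hinge-v , hinge⇒u⊎v
  ... | inj₂ refl = u , hinge-u , swap ∘ hinge⇒u⊎v

  link-left : ∀ {x y} → Link G₁ x y → UEq (u , v) (φ₁ x , φ₁ y) ⊎ Link H (φ₁ x) (φ₁ y)
  link-left (e , ue) with e ≟ e₁
  ... | yes refl = inj₁ (mapPair-uEq⁺ φ₁ ue)
  ... | no e≢e₁  =
    inj₂ (_ , uEq-trans (ψ-ends₁ (e , ∉⇒T (x≢y⇒x∉⁅y⁆ e≢e₁))) (mapPair-uEq⁺ φ₁ ue))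

  data Side : Rel (Fin (n H)) 0ℓ where
    on-left  : ∀ {x y} → Link G₁ x y → Side (φ₁ x) (φ₁ y)
    on-right : ∀ {x y} → x ∈ R → y ∈ R → Side x y

  side : ∀ {x y} → Link H x y → Side x y
  side (e , ue) with Inverse.from ψ e | Inverse.strictlyInverseˡ ψ e
  ... | inj₁ f | refl with uEq-trans (uEq-sym ue) (ψ-ends₁ f)
  ...   | inj₁ (refl , refl) = on-left (edge-link G₁ (proj₁ f))
  ...   | inj₂ (refl , refl) = on-left (link-sym {G₁} (edge-link G₁ (proj₁ f)))
  side (e , ue) | inj₂ f | refl with uEq-trans (uEq-sym ue) (ψ-ends₂ f)
  ...   | inj₁ (refl , refl) = on-right (∈-image⁺ φ₂ _) (∈-image⁺ φ₂ _)
  ...   | inj₂ (refl , refl) = on-right (∈-image⁺ φ₂ _) (∈-image⁺ φ₂ _)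

  -- G₁ arises from H by contracting the right side onto one end of e₁.
  restrict-connected : {P : Pred (Fin (n H)) 0ℓ} → Decidable P →
    Connected (Link H) P → Connected (Link G₁) (P ∘ φ₁)
  restrict-connected {P} P? connected d mono {x} {y} Px Py with hinge-colour
    where
    hinge-colour : ∃[ κ ] (∀ z → Hinge (φ₁ z) → P (φ₁ z) → d z ≡ κ)
    hinge-colour with P? u
    ... | yes Pu = d u₁ , λ z hinge Pz → [ cong d ∘ φ₁-injective , at-v Pz ]′ (hinge⇒u⊎v hinge)
      where
      at-v : ∀ {z} → P (φ₁ z) → φ₁ z ≡ v → d z ≡ d u₁
      at-v Pz φz≡v =
        trans (cong d (φ₁-injective φz≡v)) (sym (mono (edge-link G₁ e₁) Pu (subst P φz≡v Pz)))
    ... | no ¬Pu = d v₁ , λ z hinge Pz →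
      [ (λ φz≡u → contradiction (subst P φz≡u Pz) ¬Pu) , cong d ∘ φ₁-injective ]′ (hinge⇒u⊎v hinge)
  ... | κ , at-hinge = trans (sym (extend-∘ φ₁-injective d κ x))
    (trans (connected (extend φ₁ d κ) extend-mono Px Py) (extend-∘ φ₁-injective d κ y))
    where
    right-colour : ∀ {z} → P z → z ∈ R → extend φ₁ d κ z ≡ κ
    right-colour {z} Pz z∈R =
      extend-const φ₁ d κ z λ { x refl → at-hinge x (∈-image⁺ φ₁ x , z∈R) Pz }
    extend-mono : Monochromatic (Link H) P (extend φ₁ d κ)
    extend-mono x~y Px Py with side x~y
    ... | on-left {x} {y} x~₁y = trans (extend-∘ φ₁-injective d κ x)
      (trans (mono x~₁y Px Py) (sym (extend-∘ φ₁-injective d κ y)))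
    ... | on-right x∈R y∈R     = trans (right-colour Px x∈R) (sym (right-colour Py y∈R))

  record RightConnected (P : Pred (Fin (n H)) 0ℓ) : Set where
    field
      connected : Connected (Link H) (λ z → z ∈ R × P z)
      anchored  : (∃[ h ] (Hinge h × P h)) ⊎ (∀ {z} → z ∈ R → ¬ P z)

  glue-connected : {P : Pred (Fin (n H)) 0ℓ} →
    Connected (Link G₁) (P ∘ φ₁) → RightConnected P → Connected (Link H) P
  glue-connected {P} connected₁ right-connected c mono {x} {y} Px Py = compare anchored
    where
    open RightConnected right-connected
    on-R : ∀ {x y} → x ∈ R → y ∈ R → P x → P y → c x ≡ c y
    on-R x∈R y∈R Px Py =
      connected c (λ x~y (_ , Px) (_ , Py) → mono x~y Px Py) (x∈R , Px) (y∈R , Py)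
    mono₁ : Monochromatic (Link G₁) (P ∘ φ₁) (c ∘ φ₁)
    mono₁ x~y Px Py with link-left x~y | uv∈R
    ... | inj₂ φx~φy            | _         = mono φx~φy Px Py
    ... | inj₁ (inj₁ (u≡ , v≡)) | u∈R , v∈R = on-R (subst (_∈ R) u≡ u∈R) (subst (_∈ R) v≡ v∈R) Px Py
    ... | inj₁ (inj₂ (u≡ , v≡)) | u∈R , v∈R = on-R (subst (_∈ R) v≡ v∈R) (subst (_∈ R) u≡ u∈R) Px Py
    on-L : ∀ {x y} → x ∈ L → y ∈ L → P x → P y → c x ≡ c y
    on-L {x} {y} x∈L y∈L Px Py with ∈-image⁻ {φ = φ₁} {x} x∈L | ∈-image⁻ {φ = φ₁} {y} y∈L
    ... | _ , refl | _ , refl = connected₁ (c ∘ φ₁) mono₁ Px Py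
    compare : (∃[ h ] (Hinge h × P h)) ⊎ (∀ {z} → z ∈ R → ¬ P z) → c x ≡ c y
    compare (inj₁ (h , (h∈L , h∈R) , Ph)) = trans (to-h Px) (sym (to-h Py))
      where
      to-h : ∀ {z} → P z → c z ≡ c h
      to-h {z} Pz = [ (λ z∈L → on-L z∈L h∈L Pz Ph) , (λ z∈R → on-R z∈R h∈R Pz Ph) ]′ (∈L⊎∈R z)
    compare (inj₂ P∩R-empty) = on-L (in-L Px) (in-L Py) Px Py
      where
      in-L : ∀ {z} → P z → z ∈ L
      in-L {z} Pz = [ id , (λ z∈R → contradiction Pz (P∩R-empty z∈R)) ]′ (∈L⊎∈R z)

  restrict-twoConnected : ∀ {X} → TwoConnectedOn H X → AtLeastTwo (X ∘ φ₁) →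
    TwoConnectedOn G₁ (X ∘ φ₁)
  restrict-twoConnected {X} X-conn two = record
    { two = two
    ; connected = restrict-connected (_∈? X) connected
    ; connected-∖ = λ w → connected-resp-≐
        (map₂ (_∘ cong φ₁) , map₂ (λ z≢w → z≢w ∘ φ₁-injective))
        (restrict-connected ((_∈? X) ∖? φ₁ w) (connected-∖ (φ₁ w))) }
    where open TwoConnectedOn X-conn using (connected; connected-∖)

  glue-twoConnected : ∀ {X} → TwoConnectedOn G₁ (X ∘ φ₁) →
    RightConnected (_∈ X) → (∀ w → RightConnected ((_∈ X) ∖ w)) → TwoConnectedOn H X
  glue-twoConnected {X} X₁-conn right right-∖ = record
    { two = let x , y , x≢y , x∈X , y∈X = two in φ₁ x , φ₁ y , x≢y ∘ φ₁-injective , x∈X , y∈X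
    ; connected = glue-connected connected right
    ; connected-∖ = λ w → glue-connected (connected-∖-φ₁ w) (right-∖ w) }
    where
    open TwoConnectedOn X₁-conn
    connected-∖-φ₁ : ∀ w → Connected (Link G₁) (((_∈ X) ∖ w) ∘ φ₁)
    connected-∖-φ₁ w with any? (λ x → w ≟ φ₁ x)
    ... | yes (x , refl) = connected-resp-≐
      (map₂ (λ z≢x → z≢x ∘ φ₁-injective) , map₂ (_∘ cong φ₁)) (connected-∖ x)
    ... | no w∉L = connected-resp-≐
      ((λ {x} x∈X → x∈X , λ φx≡w → w∉L (x , sym φx≡w)) , proj₁) connected

  -- A thin set contains at most one vertex of R, namely the hinge other than h.
  record Thin (X : Subset (n H)) : Set where
    field
      {h}     : Fin (n H)
      h-hinge : Hinge h
      h∉X     : h ∉ X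
      X⊆L     : X ⊆ L

    unique : ∀ {a b} → a ∈ R → b ∈ R → a ∈ X → b ∈ X → a ≡ b
    unique {a} {b} a∈R b∈R a∈X b∈X with other-hinge h-hinge
    ... | _ , _ , h⊎g with h⊎g (X⊆L a a∈X , a∈R) | h⊎g (X⊆L b b∈X , b∈R)
    ... | inj₁ refl | _         = contradiction h∉X (not-¬ a∈X)
    ... | inj₂ _    | inj₁ refl = contradiction h∉X (not-¬ b∈X)
    ... | inj₂ refl | inj₂ refl = refl

  RightTrivial : Subset (n H) → Set
  RightTrivial X = R ⊆ X ⊎ Thin X

  restrict-good : ∀ {X} → RightTrivial X → Good H X → Good G₁ (X ∘ φ₁)
  restrict-good {X} trivial good = record
    { proper = proper₁ trivial ; inside = restrict-twoConnected inside (two₁ trivial)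
    ; outside = restrict-connected (_∉? X) outside }
    where
    open Good good
    proper₁ : RightTrivial X → Proper (X ∘ φ₁)
    proper₁ (inj₁ R⊆X) with proper
    ... | z , z∉X with cover z
    ... | inj₁ (x , refl) = x , z∉X
    ... | inj₂ (y , refl) = contradiction z∉X (not-¬ (R⊆X z (∈-image⁺ φ₂ y)))
    proper₁ (inj₂ record { h = h ; h-hinge = h∈L , _ ; h∉X = h∉X }) with ∈-image⁻ {φ = φ₁} {h} h∈L
    ... | x , refl = x , h∉X
    two₁ : RightTrivial X → AtLeastTwo (X ∘ φ₁)
    two₁ (inj₁ R⊆X) = u₁ , v₁ , loopFree₁ e₁ , R⊆X u (proj₁ uv∈R) , R⊆X v (proj₂ uv∈R)
    two₁ (inj₂ thin) with TwoConnectedOn.two inside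
    ... | a , b , a≢b , a∈X , b∈X
      with ∈-image⁻ {φ = φ₁} {a} (Thin.X⊆L thin a a∈X) | ∈-image⁻ {φ = φ₁} {b} (Thin.X⊆L thin b b∈X)
    ... | x , refl | y , refl = x , y , a≢b ∘ cong φ₁ , a∈X , b∈X

  module _ (R-conn : TwoConnectedOn H R) where

    open TwoConnectedOn R-conn using (connected; connected-∖)

    filled-inside : ∀ {X} → R ⊆ X → RightConnected (_∈ X)
    filled-inside R⊆X = record
      { connected = connected-resp-≐ ((λ z∈R → z∈R , R⊆X _ z∈R) , proj₁) connected
      ; anchored  = inj₁ (u , hinge-u , R⊆X u (proj₁ uv∈R)) }

    filled-inside-∖ : ∀ {X} → R ⊆ X → ∀ w → RightConnected ((_∈ X) ∖ w)
    filled-inside-∖ {X} R⊆X w = record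
      { connected = connected-resp-≐
          ((λ (z∈R , z≢w) → z∈R , R⊆X _ z∈R , z≢w) , map₂ proj₂) (connected-∖ w)
      ; anchored  = inj₁ (anchor (u ≟ w)) }
      where
      anchor : Dec (u ≡ w) → ∃[ h ] (Hinge h × ((_∈ X) ∖ w) h)
      anchor (no u≢w)   = u , hinge-u , R⊆X u (proj₁ uv∈R) , u≢w
      anchor (yes refl) = v , hinge-v , R⊆X v (proj₂ uv∈R) , u≢v ∘ sym

    filled-outside : ∀ {X} → R ⊆ X → RightConnected (_∉ X)
    filled-outside R⊆X = record
      { connected = connected-subsingleton λ (x∈R , x∉X) → contradiction x∉X (not-¬ (R⊆X _ x∈R))
      ; anchored  = inj₂ λ z∈R → not-¬ (R⊆X _ z∈R) }

    module _ {X} (thin : Thin X) where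

      open Thin thin

      thin-inside : {P : Pred (Fin (n H)) 0ℓ} → Decidable P → (∀ {z} → P z → z ∈ X) →
        RightConnected P
      thin-inside {P} P? P⊆X = record
        { connected = connected-subsingleton
            λ (x∈R , Px) (y∈R , Py) → unique x∈R y∈R (P⊆X Px) (P⊆X Py)
        ; anchored  = anchored (any? λ z → (z ∈? R) ×-dec P? z) }
        where
        anchored : Dec (∃[ z ] (z ∈ R × P z)) → (∃[ h ] (Hinge h × P h)) ⊎ (∀ {z} → z ∈ R → ¬ P z)
        anchored (yes (z , z∈R , Pz)) = inj₁ (z , (X⊆L z (P⊆X Pz) , z∈R) , Pz)
        anchored (no none)            = inj₂ λ z∈R Pz → none (_ , z∈R , Pz)

      thin-outside : RightConnected (_∉ X)
      thin-outside = record
        { connected = outside (any? λ z → (z ∈? R) ×-dec (z ∈? X))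
        ; anchored  = inj₁ (h , h-hinge , h∉X) }
        where
        outside : Dec (∃[ z ] (z ∈ R × z ∈ X)) → Connected (Link H) (λ z → z ∈ R × z ∉ X)
        outside (no none) = connected-resp-≐
          ((λ z∈R → z∈R , ¬-not (λ z∈X → none (_ , z∈R , z∈X))) , proj₁) connected
        outside (yes (g , g∈R , g∈X)) = connected-resp-≐
          ( (λ (z∈R , z≢g) → z∈R , ¬-not (λ z∈X → z≢g (unique z∈R g∈R z∈X g∈X)))
          , map₂ (λ z∉X → ∈∉⇒≢ g∈X z∉X ∘ sym)) (connected-∖ g)

    lift-good : ∀ {X} → RightTrivial X → Good G₁ (X ∘ φ₁) → Good H X
    lift-good {X} trivial good₁ = record
      { proper  = let x , x∉X = proper in φ₁ x , x∉X
      ; inside  = inside-X trivial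
      ; outside = glue-connected outside (outside-X trivial) }
      where
      open Good good₁
      inside-X : RightTrivial X → TwoConnectedOn H X
      inside-X (inj₁ R⊆X)  = glue-twoConnected inside (filled-inside R⊆X) (filled-inside-∖ R⊆X)
      inside-X (inj₂ thin) = glue-twoConnected inside
        (thin-inside thin (_∈? X) id) (λ w → thin-inside thin ((_∈? X) ∖? w) proj₁)
      outside-X : RightTrivial X → RightConnected (_∉ X)
      outside-X = [ filled-outside , thin-outside ]

  extension : ∀ S → ∃[ X ] (X ∘ φ₁ ≗ S × RightTrivial X)
  extension S with ∈⊎∉ S u₁ | ∈⊎∉ S v₁
  ... | inj₁ u₁∈S | inj₁ v₁∈S =
    extend φ₁ S true , extend-∘ φ₁-injective S true , inj₁ λ z z∈R →
      extend-const φ₁ S true z λ { x refl → hinge∈S x (hinge⇒u⊎v (∈-image⁺ φ₁ x , z∈R)) }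
    where
    hinge∈S : ∀ x → φ₁ x ≡ u ⊎ φ₁ x ≡ v → x ∈ S
    hinge∈S x (inj₁ φx≡u) = subst (_∈ S) (sym (φ₁-injective φx≡u)) u₁∈S
    hinge∈S x (inj₂ φx≡v) = subst (_∈ S) (sym (φ₁-injective φx≡v)) v₁∈S
  ... | inj₂ u₁∉S | _ =
    extend φ₁ S false , extend-∘ φ₁-injective S false , inj₂ record
      { h-hinge = hinge-u ; h∉X = trans (extend-∘ φ₁-injective S false u₁) u₁∉S
      ; X⊆L = extend-false⊆image φ₁ S }
  ... | inj₁ _ | inj₂ v₁∉S =
    extend φ₁ S false , extend-∘ φ₁-injective S false , inj₂ record
      { h-hinge = hinge-v ; h∉X = trans (extend-∘ φ₁-injective S false v₁) v₁∉S
      ; X⊆L = extend-false⊆image φ₁ S }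

  one-sided : {P : Pred (Fin (n H)) 0ℓ} → Decidable P → Connected (Link H) P →
    (∀ {z} → P z → ¬ Hinge z) → (∀ z → P z → z ∈ L) ⊎ (∀ z → P z → z ∈ R)
  one-sided {P} P? connected no-hinge with any? P?
  ... | no empty = inj₁ λ _ Pz → contradiction (_ , Pz) empty
  ... | yes (a , Pa) = Sum.map
    (λ a∈L z Pz → trans (like-a Pz) a∈L)
    (λ a∉L z Pz → [ (λ z∈L → contradiction (trans (like-a Pz) a∉L) (not-¬ z∈L)) , id ]′ (∈L⊎∈R z))
    (∈⊎∉ L a)
    where
    L-mono : Monochromatic (Link H) P L
    L-mono x~y Px Py with side x~y
    ... | on-left {x} {y} _ = trans (∈-image⁺ φ₁ x) (sym (∈-image⁺ φ₁ y))
    ... | on-right x∈R y∈R  = trans (∉L Px x∈R) (sym (∉L Py y∈R))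
      where
      ∉L : ∀ {z} → P z → z ∈ R → z ∉ L
      ∉L Pz z∈R = ¬-not λ z∈L → no-hinge Pz (z∈L , z∈R)
    like-a : ∀ {z} → P z → L z ≡ L a
    like-a Pz = connected L L-mono Pz Pa

  vertex-counts : ∀ X → size X + size (X ∩ L ∩ R) ≡ size (X ∘ φ₁) + size (X ∘ φ₂)
  vertex-counts = size-cover φ₁-injective (φ₂-inj _ _) L∪R-universal

  edge-counts : ∀ X → (𝟙 (inE G₁ (X ∘ φ₁) e₁) + 𝟙 (inE G₂ (X ∘ φ₂) e₂)) + edges H X ≡
    edges G₁ (X ∘ φ₁) + edges G₂ (X ∘ φ₂)
  edge-counts X = size-other-⊎-↔ e₁ e₂ ψ (inE H X) (inE G₁ (X ∘ φ₁)) (inE G₂ (X ∘ φ₂))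
    (uEq-∧ X ∘ ψ-ends₁) (uEq-∧ X ∘ ψ-ends₂)

  module _ {X} (R⊆X : R ⊆ X) where

    X∘φ₂-universal : ∀ y → φ₂ y ∈ X
    X∘φ₂-universal y = R⊆X _ (∈-image⁺ φ₂ y)

    pair≗X∩L∩R : pair u v ≗ X ∩ L ∩ R
    pair≗X∩L∩R z = ⇔→≡ (mk⇔
      (pair⊆ (X ∩ L ∩ R) (hinge∈ hinge-u) (hinge∈ hinge-v) z)
      (λ z∈ → [ (λ { refl → x∈pair-xy u v }) , (λ { refl → y∈pair-xy u v }) ]′
        (hinge⇒u⊎v (∧-true⁻ _ _ (∧-conicalʳ (X z) _ z∈)))))
      where
      hinge∈ : ∀ {z} → Hinge z → z ∈ X ∩ L ∩ R
      hinge∈ (z∈L , z∈R) = cong₂ _∧_ (R⊆X _ z∈R) (cong₂ _∧_ z∈L z∈R)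

    filled-size : size X + 2 ≡ size (X ∘ φ₁) + size (X ∘ φ₂)
    filled-size = trans
      (cong (size X +_) (trans (sym (size-pair u≢v)) (size-cong pair≗X∩L∩R))) (vertex-counts X)

    filled-edges : 2 + edges H X ≡ edges G₁ (X ∘ φ₁) + edges G₂ (X ∘ φ₂)
    filled-edges = trans (sym (cong₂ (λ a b → 𝟙 a + 𝟙 b + edges H X)
      (cong₂ _∧_ (R⊆X u (proj₁ uv∈R)) (R⊆X v (proj₂ uv∈R)))
      (cong₂ _∧_ (X∘φ₂-universal _) (X∘φ₂-universal _)))) (edge-counts X)

  module _ {X} (thin : Thin X) where

    open Thin thin

    thin-size : size X ≡ size (X ∘ φ₁)
    thin-size = trans
      (size-cong λ z → ⇔→≡ (mk⇔ (λ z∈X → cong₂ _∧_ z∈X (X⊆L z z∈X)) (∧-conicalˡ (X z) (L z))))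
      (sym (size-∘-injective φ₁-injective X))

    thin-edges : edges H X ≡ edges G₁ (X ∘ φ₁)
    thin-edges = begin
      edges H X
        ≡⟨ cong₂ (λ a b → 𝟙 a + 𝟙 b + edges H X) e₁∉ (subsingleton⇒∉inE loopFree₂ unique₂ e₂) ⟨
      𝟙 (inE G₁ (X ∘ φ₁) e₁) + 𝟙 (inE G₂ (X ∘ φ₂) e₂) + edges H X
        ≡⟨ edge-counts X ⟩
      edges G₁ (X ∘ φ₁) + edges G₂ (X ∘ φ₂)
        ≡⟨ cong (edges G₁ (X ∘ φ₁) +_) (edges-subsingleton loopFree₂ unique₂) ⟩
      edges G₁ (X ∘ φ₁) + 0
        ≡⟨ +-identityʳ _ ⟩
      edges G₁ (X ∘ φ₁) ∎
      where
      open ≡-Reasoning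
      unique₂ : ∀ {x y} → φ₂ x ∈ X → φ₂ y ∈ X → x ≡ y
      unique₂ {x} {y} x∈X y∈X = φ₂-inj x y (unique (∈-image⁺ φ₂ x) (∈-image⁺ φ₂ y) x∈X y∈X)
      e₁∉ : e₁ ∉ inE G₁ (X ∘ φ₁)
      e₁∉ = ¬-not λ e₁∈ → let u∈X , v∈X = ∧-true⁻ _ _ e₁∈ in
        u≢v (unique (proj₁ uv∈R) (proj₂ uv∈R) u∈X v∈X)

  module _ (total₂ : Tight 2 G₂ full) where

    restriction-balance : ∀ {X} → RightTrivial X →
      edges H X + 2 * size (X ∘ φ₁) ≡ edges G₁ (X ∘ φ₁) + 2 * size X
    restriction-balance {X} (inj₁ R⊆X) = +-cancelʳ-≡ (2 + 2 * s₂) _ _ (begin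
      e + 2 * s₁ + (2 + 2 * s₂)    ≡⟨ regroup e s₁ s₂ ⟩
      2 + e + 2 * (s₁ + s₂)        ≡⟨ cong (_+ 2 * (s₁ + s₂)) (filled-edges R⊆X) ⟩
      a₁ + a₂ + 2 * (s₁ + s₂)      ≡⟨ cong (λ a → a₁ + a₂ + 2 * a) (filled-size R⊆X) ⟨
      a₁ + a₂ + 2 * (s + 2)        ≡⟨ regroup′ a₁ a₂ s ⟩
      a₁ + 2 * s + (2 + (a₂ + 2))  ≡⟨ cong (λ a → a₁ + 2 * s + (2 + a)) tight₂ ⟩
      a₁ + 2 * s + (2 + 2 * s₂)    ∎)
      where
      open ≡-Reasoning
      e s a₁ s₁ a₂ s₂ : ℕ
      e  = edges H X
      s  = size X
      a₁ = edges G₁ (X ∘ φ₁)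
      s₁ = size (X ∘ φ₁)
      a₂ = edges G₂ (X ∘ φ₂)
      s₂ = size (X ∘ φ₂)
      tight₂ : Tight 2 G₂ (X ∘ φ₂)
      tight₂ = tight-cong G₂ 2 (sym ∘ X∘φ₂-universal R⊆X) total₂
      regroup : ∀ e s₁ s₂ → e + 2 * s₁ + (2 + 2 * s₂) ≡ 2 + e + 2 * (s₁ + s₂)
      regroup = solve-∀
      regroup′ : ∀ a₁ a₂ s → a₁ + a₂ + 2 * (s + 2) ≡ a₁ + 2 * s + (2 + (a₂ + 2))
      regroup′ = solve-∀
    restriction-balance (inj₂ thin) =
      cong₂ (λ a b → a + 2 * b) (thin-edges thin) (sym (thin-size thin))

    restriction-tight⇔ : ∀ j {X} → RightTrivial X → Tight j G₁ (X ∘ φ₁) ⇔ Tight j H X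
    restriction-tight⇔ j {X} trivial = mk⇔
      (transfer (size X) (size (X ∘ φ₁)) (restriction-balance trivial))
      (transfer (size (X ∘ φ₁)) (size X) (sym (restriction-balance trivial)))
      where
      open ≡-Reasoning
      transfer : ∀ {e e′} s s′ → e + 2 * s′ ≡ e′ + 2 * s → e′ + j ≡ 2 * s′ → e + j ≡ 2 * s
      transfer {e} {e′} s s′ balance e′+j≡2s′ = +-cancelʳ-≡ (2 * s′) (e + j) (2 * s) (begin
        e + j + 2 * s′   ≡⟨ xy∙z≈xz∙y e j (2 * s′) ⟩
        e + 2 * s′ + j   ≡⟨ cong (_+ j) balance ⟩
        e′ + 2 * s + j   ≡⟨ xy∙z≈xz∙y e′ (2 * s) j ⟩
        e′ + j + 2 * s   ≡⟨ cong (_+ 2 * s) e′+j≡2s′ ⟩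
        2 * s′ + 2 * s   ≡⟨ +-comm (2 * s′) (2 * s) ⟩
        2 * s + 2 * s′   ∎)

module _ (C : ConstrA 2 G₁ G₂ H) where

  private
    module C  = Gluing C
    module C˘ = Gluing (constrA-swap C)

  good⇒trivial : ∀ {X} → Good H X → C.RightTrivial X ⊎ C˘.RightTrivial X
  good⇒trivial {X} good with any? (λ h → ((h ∈? C.L) ×-dec (h ∈? C.R)) ×-dec (h ∉? X))
  ... | no hinges∈X = Sum.map
    (λ ∁X⊆L → inj₁ λ z z∈R → ¬-not λ z∉X → hinges∈X (z , (∁X⊆L z z∉X , z∈R) , z∉X))
    (λ ∁X⊆R → inj₁ λ z z∈L → ¬-not λ z∉X → hinges∈X (z , (z∈L , ∁X⊆R z z∉X) , z∉X))
    (C.one-sided (_∉? X) (Good.outside good) λ z∉X hinge → hinges∈X (_ , hinge , z∉X))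
  ... | yes (h , (h∈L , h∈R) , h∉X) with C.other-hinge (h∈L , h∈R)
  ... | g , (g∈L , g∈R) , h⊎g = Sum.map
    (λ X∖g⊆L → inj₂ record { h-hinge = h∈L , h∈R ; h∉X = h∉X ; X⊆L = insert-g g∈L X∖g⊆L })
    (λ X∖g⊆R → inj₂ record { h-hinge = h∈R , h∈L ; h∉X = h∉X ; X⊆L = insert-g g∈R X∖g⊆R })
    (C.one-sided ((_∈? X) ∖? g) (TwoConnectedOn.connected-∖ (Good.inside good) g) no-hinge)
    where
    no-hinge : ∀ {z} → ((_∈ X) ∖ g) z → ¬ C.Hinge z
    no-hinge (z∈X , z≢g) hinge = [ ∈∉⇒≢ z∈X h∉X , z≢g ] (h⊎g hinge)
    insert-g : ∀ {S} → g ∈ S → (∀ z → ((_∈ X) ∖ g) z → z ∈ S) → X ⊆ S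
    insert-g g∈S X∖g⊆S z z∈X with z ≟ g
    ... | yes refl = g∈S
    ... | no z≢g   = X∖g⊆S z (z∈X , z≢g)

  glue-balanced : Balanced G₁ → Balanced G₂ → Balanced H
  glue-balanced balanced₁ balanced₂ = record
    { total = Equivalence.to (C.restriction-tight⇔ B₂.total 2 (inj₁ λ _ _ → refl)) B₁.total
    ; flat  = λ good → flat good (good⇒trivial good) }
    where
    module B₁ = Balanced balanced₁
    module B₂ = Balanced balanced₂
    flat : ∀ {X} → Good H X → C.RightTrivial X ⊎ C˘.RightTrivial X → Tight 3 H X
    flat good (inj₁ trivial) = Equivalence.to
      (C.restriction-tight⇔ B₂.total 3 trivial) (B₁.flat (C.restrict-good trivial good))
    flat good (inj₂ trivial) = Equivalence.to
      (C˘.restriction-tight⇔ B₁.total 3 trivial) (B₂.flat (C˘.restrict-good trivial good))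

  unglue-balanced : TwoConnectedOn H C.R → Tight 2 G₁ full → Tight 2 G₂ full →
    Balanced H → Balanced G₁
  unglue-balanced R-conn total₁ total₂ balanced = record { total = total₁ ; flat = flat }
    where
    flat : ∀ {S} → Good G₁ S → Tight 3 G₁ S
    flat {S} good = let X , X∘φ₁≗S , trivial = C.extension S in
      tight-cong G₁ 3 X∘φ₁≗S (Equivalence.from (C.restriction-tight⇔ total₂ 3 trivial)
        (Balanced.flat balanced (C.lift-good R-conn trivial (good-cong (sym ∘ X∘φ₁≗S) good))))

-- Splitting along a 2-vertex cut

enumeration : (S : Subset k) → Fin (size S) ↔ (∃[ x ] T (S x))
enumeration {zero}  S = mk↔ₛ′ (λ ()) (λ ()) (λ ()) (λ ())
enumeration {suc k} S = (∃-suc ↔-∘ (𝟙↔T (S zero) ⊎-↔ enumeration (S ∘ suc))) ↔-∘ +↔⊎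
  where
  𝟙↔T : ∀ b → Fin (𝟙 b) ↔ T b
  𝟙↔T true  = 1↔⊤
  𝟙↔T false = 0↔⊥
  ∃-suc : (T (S zero) ⊎ ∃[ x ] T (S (suc x))) ↔ (∃[ x ] T (S x))
  ∃-suc = mk↔ₛ′ (λ { (inj₁ p) → zero , p ; (inj₂ (x , p)) → suc x , p })
                (λ { (zero , p) → inj₁ p ; (suc x , p) → inj₂ (x , p) })
                (λ { (zero , p) → refl ; (suc x , p) → refl })
                (λ { (inj₁ p) → refl ; (inj₂ (x , p)) → refl })

partition↔ : (S S′ : Subset k) → (∀ x → x ∈ S ∪ S′) → (∀ x → x ∉ S ∩ S′) →
  ((∃[ x ] T (S x)) ⊎ (∃[ x ] T (S′ x))) ↔ Fin k
partition↔ {k} S S′ cover disjoint = mk↔ₛ′ to (proj₁ ∘ preimage) (proj₂ ∘ preimage)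
  (λ a → to-injective (proj₁ (preimage (to a))) a (proj₂ (preimage (to a))))
  where
  to : (∃[ x ] T (S x)) ⊎ (∃[ x ] T (S′ x)) → Fin k
  to = [ proj₁ , proj₁ ]
  preimage : ∀ x → ∃[ a ] to a ≡ x
  preimage x = [ (λ x∈S → inj₁ (x , ∈⇒T x∈S) , refl) , (λ x∈S′ → inj₂ (x , ∈⇒T x∈S′) , refl) ]′
    (∨-true⁻ _ _ (cover x))
  not-both : ∀ {x} → T (S x) → T (S′ x) → ⊥
  not-both p q = not-¬ (cong₂ _∧_ (T⇒∈ p) (T⇒∈ q)) (disjoint _)
  to-injective : ∀ a b → to a ≡ to b → a ≡ b
  to-injective (inj₁ a)       (inj₁ b)        eq   = cong inj₁ (∃-T-≡ {S = S} eq)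
  to-injective (inj₂ a)       (inj₂ b)        eq   = cong inj₂ (∃-T-≡ {S = S′} eq)
  to-injective (inj₁ (x , p)) (inj₂ (.x , q)) refl = contradiction q (not-both p)
  to-injective (inj₂ (x , p)) (inj₁ (.x , q)) refl = contradiction p (not-both q)

module SideGraph (G : MGraph) (S : Subset (n G)) {u v : Fin (n G)} (u∈S : u ∈ S) (v∈S : v ∈ S) where

  private
    module Vertices = Inverse (enumeration S)
    module Edges    = Inverse (enumeration (inE G S))

  φ : Fin (size S) → Fin (n G)
  φ = proj₁ ∘ Vertices.to

  index : ∀ {x} → x ∈ S → Fin (size S)
  index x∈S = Vertices.from (_ , ∈⇒T x∈S)

  φ-index : ∀ {x} (x∈S : x ∈ S) → φ (index x∈S) ≡ x
  φ-index x∈S = cong proj₁ (Vertices.strictlyInverseˡ (_ , ∈⇒T x∈S))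

  φ∈S : ∀ i → φ i ∈ S
  φ∈S i = T⇒∈ (proj₂ (Vertices.to i))

  φ-injective : Injective _≡_ _≡_ φ
  φ-injective φi≡φj = Injection.injective (↔⇒↣ (enumeration S)) (∃-T-≡ {S = S} φi≡φj)

  index-injective : ∀ {x y} (x∈S : x ∈ S) (y∈S : y ∈ S) → index x∈S ≡ index y∈S → x ≡ y
  index-injective x∈S y∈S eq = trans (sym (φ-index x∈S)) (trans (cong φ eq) (φ-index y∈S))

  image-φ : image φ ≗ S
  image-φ z = ⇔→≡ (mk⇔
    (λ z∈φ → let i , φi≡z = ∈-image⁻ {φ = φ} {z} z∈φ in subst (_∈ S) φi≡z (φ∈S i))
    (λ z∈S → subst (_∈ image φ) (φ-index z∈S) (∈-image⁺ φ (index z∈S))))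

  edge : Fin (edges G S) → Fin (m G)
  edge = proj₁ ∘ Edges.to

  edge-inside : ∀ j → proj₁ (endsG G (edge j)) ∈ S × proj₂ (endsG G (edge j)) ∈ S
  edge-inside j = ∧-true⁻ _ _ (T⇒∈ (proj₂ (Edges.to j)))

  sideGraph : MGraph
  sideGraph = record
    { n = size S ; m = suc (edges G S)
    ; ends = λ { zero    → index u∈S , index v∈S
               ; (suc j) → let a∈S , b∈S = edge-inside j in index a∈S , index b∈S } }

  φ-ends : ∀ j → UEq (endsG G (edge j)) (mapPair φ (endsG sideGraph (suc j)))
  φ-ends j = let a∈S , b∈S = edge-inside j in inj₁ (sym (φ-index a∈S) , sym (φ-index b∈S))

  sideGraph-loopFree : LoopFree G → u ≢ v → LoopFree sideGraph
  sideGraph-loopFree loopFree u≢v zero    = u≢v ∘ index-injective u∈S v∈S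
  sideGraph-loopFree loopFree u≢v (suc j) = loopFree (edge j) ∘ index-injective _ _

  lift-link : ∀ {x y} → Link G (φ x) (φ y) → Link sideGraph x y
  lift-link {x} {y} (e , ue) = suc j , mapPair-uEq⁻ φ-injective (uEq-trans (uEq-sym (φ-ends j))
    (subst (λ e → UEq (endsG G e) (φ x , φ y)) (sym edge-j≡e) ue))
    where
    e-inside : T (inE G S e)
    e-inside = ∈⇒T (trans (uEq-∧ S ue) (cong₂ _∧_ (φ∈S x) (φ∈S y)))
    j : Fin (edges G S)
    j = Edges.from (e , e-inside)
    edge-j≡e : edge j ≡ e
    edge-j≡e = cong proj₁ (Edges.strictlyInverseˡ (e , e-inside))

  sideGraph-connected : {P : Pred (Fin (n G)) 0ℓ} →
    Connected (Link G) (λ z → z ∈ S × P z) → Connected (Link sideGraph) (P ∘ φ)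
  sideGraph-connected {P} connected d mono {x} {y} Px Py = begin
    d x                    ≡⟨ extend-∘ φ-injective d true x ⟨
    extend φ d true (φ x)  ≡⟨ connected (extend φ d true) extend-mono (φ∈S x , Px) (φ∈S y , Py) ⟩
    extend φ d true (φ y)  ≡⟨ extend-∘ φ-injective d true y ⟩
    d y                    ∎
    where
    open ≡-Reasoning
    extend-mono : Monochromatic (Link G) (λ z → z ∈ S × P z) (extend φ d true)
    extend-mono {a} {b} a~b (a∈S , Pa) (b∈S , Pb)
      with ∈-image⁻ {φ = φ} {a} (trans (image-φ a) a∈S)
         | ∈-image⁻ {φ = φ} {b} (trans (image-φ b) b∈S)
    ... | x , refl | y , refl = trans (extend-∘ φ-injective d true x)
      (trans (mono (lift-link a~b) Pa Pb) (sym (extend-∘ φ-injective d true y)))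

  sideGraph-twoConnected : u ≢ v → TwoConnectedOn G S → TwoConnected sideGraph
  sideGraph-twoConnected u≢v S-conn = record
    { two = index u∈S , index v∈S , u≢v ∘ index-injective u∈S v∈S , refl , refl
    ; connected = sideGraph-connected (connected-resp-≐ ((_, refl) , proj₁) connected)
    ; connected-∖ = λ w → connected-resp-≐
        ((λ φz≢φw → refl , φz≢φw ∘ cong φ) , (λ (_ , z≢w) → z≢w ∘ φ-injective))
        (sideGraph-connected (connected-∖ (φ w))) }
    where open TwoConnectedOn S-conn using (connected; connected-∖)

module Splitting {G : MGraph} (loopFree : LoopFree G) (G-conn : TwoConnected G)
  (balanced : Balanced G) {u v : Fin (n G)} (u≢v : u ≢ v) where

  open Sparsity loopFree G-conn balanced

  module Piece (sep : Separation G full (pair u v)) where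

    open Separation sep public
    open SideGraph G L (C⊆L u (x∈pair-xy u v)) (C⊆L v (y∈pair-xy u v)) public

    L-good : Good G L
    L-good = side-good u≢v sep

    image-twoConnected : TwoConnectedOn G (image φ)
    image-twoConnected = twoConnectedOn-cong (sym ∘ image-φ) (Good.inside L-good)

    piece-loopFree : LoopFree sideGraph
    piece-loopFree = sideGraph-loopFree loopFree u≢v

    piece-twoConnected : TwoConnected sideGraph
    piece-twoConnected = sideGraph-twoConnected u≢v (Good.inside L-good)

    piece-total : Tight 2 sideGraph full
    piece-total = Equivalence.from (full-tight⇔ sideGraph)
      (trans (sym (+-suc (edges G L) 2)) (Balanced.flat balanced L-good))

    piece-weight : WeightIs 2 sideGraph zero 1
    piece-weight = (λ _ → refl) , (λ _ → refl) , Deletion.delete⊎contract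
      piece-loopFree piece-twoConnected zero (tight⇒2≤m piece-twoConnected piece-total)

    piece<n : n sideGraph < n G
    piece<n = subst (size L <_) size-full L<Q

    3≤piece : 3 ≤ n sideGraph
    3≤piece = subst (_< size L) (size-pair u≢v) (size-mono-< (pair u v) L C⊆L x∉C x∈L)

  module _ (sep : Separation G full (pair u v)) where

    open Separation sep using (L; R; L∪R≗Q; L∩R≗C; inE-L∪R; inE-L∩R; flip)
    private
      module 𝓛 = Piece sep
      module 𝓡 = Piece flip

    edges↔ : (Other {suc (edges G L)} zero ⊎ Other {suc (edges G R)} zero) ↔ Fin (m G)
    edges↔ = partition↔ (inE G L) (inE G R) inE-L∪R (λ e → trans (inE-L∩R e) (nonadjacent e))
      ↔-∘ ((enumeration (inE G L) ↔-∘ ↔-sym (other↔ zero))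
            ⊎-↔ (enumeration (inE G R) ↔-∘ ↔-sym (other↔ zero)))
      where
      nonadjacent : ∀ e → e ∉ inE G (pair u v)
      nonadjacent e = ¬-not λ e∈ → contradiction (nonempty⇒1≤size (inE G (pair u v)) (e , e∈))
        (<⇒≱ (s≤s (≤-reflexive (twoCut-nonadjacent u≢v sep))))

    split : ConstrA 2 𝓛.sideGraph 𝓡.sideGraph G
    split = record
      { tc₁ = twoConnected⇒twoConn 𝓛.piece-loopFree 𝓛.piece-twoConnected
      ; tc₂ = twoConnected⇒twoConn 𝓡.piece-loopFree 𝓡.piece-twoConnected
      ; e₁ = zero ; e₂ = zero ; w₁ = 𝓛.piece-weight ; w₂ = 𝓡.piece-weight
      ; φ₁ = 𝓛.φ ; φ₂ = 𝓡.φ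
      ; φ₁-inj = λ _ _ → 𝓛.φ-injective ; φ₂-inj = λ _ _ → 𝓡.φ-injective
      ; cover = λ z → Sum.map (λ z∈L → _ , 𝓛.φ-index z∈L) (λ z∈R → _ , 𝓡.φ-index z∈R)
          (∨-true⁻ (L z) (R z) (L∪R≗Q z))
      ; glue = inj₁ ( trans (𝓛.φ-index _) (sym (𝓡.φ-index _))
                    , trans (𝓛.φ-index _) (sym (𝓡.φ-index _)))
      ; only-glue = λ x y φx≡φy → Sum.map (≡index _) (≡index _) (z∈pair-xy⇒z≡x⊎z≡y {z = 𝓛.φ x}
          (trans (sym (L∩R≗C (𝓛.φ x))) (cong₂ _∧_ (𝓛.φ∈S x) (subst (_∈ R) (sym φx≡φy) (𝓡.φ∈S y)))))
      ; ψ = edges↔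
      ; ψ-ends₁ = λ { (suc j , _) → 𝓛.φ-ends j }
      ; ψ-ends₂ = λ { (suc j , _) → 𝓡.φ-ends j } }
      where
      ≡index : ∀ {x w} (w∈L : w ∈ L) → 𝓛.φ x ≡ w → x ≡ 𝓛.index w∈L
      ≡index w∈L φx≡w = 𝓛.φ-injective (trans φx≡w (sym (𝓛.φ-index w∈L)))

    left-balanced : Balanced 𝓛.sideGraph
    left-balanced =
      unglue-balanced split 𝓡.image-twoConnected 𝓛.piece-total 𝓡.piece-total balanced

    right-balanced : Balanced 𝓡.sideGraph
    right-balanced =
      unglue-balanced (constrA-swap split) 𝓛.image-twoConnected 𝓡.piece-total 𝓛.piece-total balanced

TwoCut : MGraph → Set
TwoCut G = ∃[ u ] ∃[ v ] (u ≢ v × Cut (Link G) (_∉ pair u v))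

twoCut? : ∀ G → TwoCut G ⊎ (∀ u v → u ≢ v → Connected (Link G) (_∉ pair u v))
twoCut? G = any⊎all λ u → any⊎all λ v → decide u v
  where
  decide : ∀ u v → (u ≢ v × Cut (Link G) (_∉ pair u v)) ⊎ (u ≢ v → Connected (Link G) (_∉ pair u v))
  decide u v with u ≟ v | linked⊎cut G (_∉? pair u v)
  ... | yes u≡v | _              = inj₂ λ u≢v → contradiction u≡v u≢v
  ... | no u≢v  | inj₁ connected = inj₂ λ _ → connected
  ... | no u≢v  | inj₂ cut       = inj₁ (u≢v , cut)

-- The classification

balanced⇒classA : ∀ G → Acc _<_ (n G) → LoopFree G → TwoConnected G → Balanced G → 3 ≤ n G →
  ClassA 2 G
balanced⇒classA G (acc rec) loopFree G-conn balanced 3≤n with twoCut? G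
... | inj₂ connected-∖∖ = base (ThreeConnected.isK₄ loopFree G-conn balanced 3≤n connected-∖∖)
... | inj₁ (u , v , u≢v , cut) = step
  (balanced⇒classA _ (rec 𝓛.piece<n)
    𝓛.piece-loopFree 𝓛.piece-twoConnected (left-balanced sep) 𝓛.3≤piece)
  (balanced⇒classA _ (rec 𝓡.piece<n)
    𝓡.piece-loopFree 𝓡.piece-twoConnected (right-balanced sep) 𝓡.3≤piece)
  (split sep)
  where
  open Splitting loopFree G-conn balanced u≢v
  sep : Separation G full (pair u v)
  sep = cut⇒separation (λ _ _ → refl) (cut-resp-≐ ((refl ,_) , proj₂) cut)
  module 𝓛 = Piece sep
  module 𝓡 = Piece (Separation.flip sep)

classA⇒balanced : ClassA 2 G → Balanced G
classA⇒balanced (base k₄)      = K₄⇒balanced k₄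
classA⇒balanced (step c₁ c₂ C) = glue-balanced C (classA⇒balanced c₁) (classA⇒balanced c₂)

balanced⇔C₂⊎classA : LoopFree G → TwoConnected G → Balanced G ⇔ (IsC2 G ⊎ ClassA 2 G)
balanced⇔C₂⊎classA {G} loopFree G-conn = mk⇔ classify [ C₂⇒balanced , classA⇒balanced ]
  where
  classify : Balanced G → IsC2 G ⊎ ClassA 2 G
  classify balanced with m≤n⇒m<n∨m≡n (twoConnected⇒2≤n G-conn)
  ... | inj₁ 3≤n = inj₂ (balanced⇒classA G (<-wellFounded (n G)) loopFree G-conn balanced 3≤n)
  ... | inj₂ 2≡n = inj₁ (balanced⇒C₂ loopFree balanced (sym 2≡n))

theorem2p25 : (G : MGraph) → TwoConn (toGr G) →
    (Spade 2 G ⇔ (IsC2 G ⊎ ClassA 2 G))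
theorem2p25 G G-twoConn = balanced⇔C₂⊎classA loopFree G-conn ⇔-∘ spade⇔balanced loopFree G-conn
  where
  loopFree : LoopFree G
  loopFree = proj₁ G-twoConn
  G-conn : TwoConnected G
  G-conn = twoConn⇒twoConnected G-twoConn
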